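{- (i) For every constant $C>0$ there is a constant $C'>0$ such that the following holds for every integer $n\ge 3$, every metric space $(X,d)$ with $n$ points and every integer $b\ge 0$: if there is an algorithm for metrical task systems on $(X,d)$ that uses $b$ random bits and is $C\log^2 n$-competitive, then $b\ge\log n-C'\log\log n$. (ii) There is a constant $C''>0$ such that for every integer $n\ge 2$, there is an algorithm for metrical task systems on the uniform metric space with $n$ points that uses $\lceil\log n\rceil$ random bits and is $C''\log n$-competitive.
   Context: Logarithms are in base $2$. The uniform metric space with $n$ points is a set $X$ with $|X|=n$ and $d(\rho,\rho')=1$ for all $\rho\ne\rho'$. Metrical task systems (MTS) on a finite metric space $(X,d)$: the input is a sequence of cost vectors $c=(c(t))_{t\ge 1}$ with $c(t)\in\mathbb{R}_+^X$; the output is a sequence of states $\rho=(\rho(t))_{t\ge 0}$ in $X$. Its cost is $\mathrm{Cost}(\rho,c)=\sum_{t\ge 1}\big(d(\rho(t-1),\rho(t))+c_{\rho(t)}(t)\big)$, and $\mathrm{OPT}(c)=\inf_{\rho\in X^{\mathbb{N}}}\mathrm{Cost}(\rho,c)$. An online algorithm $\mathcal{A}$ with seed distribution $\mathcal{D}$ draws one seed $s\sim\mathcal{D}$ and outputs $\rho_{\mathcal A}(t)=\mathcal{A}(c(1),\dots,c(t),s)$ for all $t\ge 0$ (so the state at time $t$ depends only on the seed and on $c(1),\dots,c(t)$). It is $\alpha$-competitive if there is a constant $\beta\in\mathbb{R}$ such that $\mathbb{E}_{s\sim\mathcal{D}}[\mathrm{Cost}(\rho_{\mathcal A},c)]\le\alpha\,\mathrm{OPT}(c)+\beta$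 for every cost sequence $c$ ($\beta$ may depend on the algorithm and on $(X,d)$, but not on $c$). An algorithm uses $b$ random bits if $\mathcal{D}$ is the uniform distribution on $\{0,1\}^b$ (equivalently on $\{1,\dots,2^b\}$). -}

module Defs where

open import Algebra.Bundles using (CommutativeRing)
open import Axiom.ExcludedMiddle using (ExcludedMiddle)
open import Data.Fin.Base using (Fin)
open import Data.List.Base using (List; applyUpTo)
open import Data.List.Relation.Binary.Pointwise.Base using (Pointwise)
open import Data.Nat.Base as ℕ using (ℕ; zero; suc)
open import Data.Product.Base using (∃; _×_; _,_; proj₁)
open import Data.Vec.Functional using (foldr)
open import Function.Bundles using (_↔_)
open import Function.Metric.Structures using (IsGeneralMetric)
open import Level using (0ℓ) renaming (suc to lsuc)
open import Relation.Binary.Core using (Rel)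
open import Relation.Binary.PropositionalEquality.Core using (_≡_; _≢_)
open import Relation.Binary.Structures using (IsTotalOrder)
open import Relation.Nullary.Construct.Add.Supremum using (_⁺; [_]; ⊤⁺)
open import Relation.Nullary.Decidable.Core using (yes; no)
open import Relation.Nullary.Negation.Core using (¬_)
import Algebra.Properties.Semiring.Exp as Exp
import Algebra.Properties.Semiring.Mult as Mult
import Relation.Binary.Construct.Add.Supremum.NonStrict as AddSupremum
import Relation.Binary.Construct.NonStrictToStrict as ToStrict

-- The real numbers, characterised (classically, up to unique isomorphism) as
-- the Dedekind-complete ordered field.
record CompleteOrderedField : Set₁ where
  infix  8 _⁻¹
  infix  4 _≤_
  field
    commutativeRing : CommutativeRing 0ℓ 0ℓ
  open CommutativeRing commutativeRing public
    hiding (zero; zeroˡ; zeroʳ) renaming (Carrier to ℝ)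
  field
    _≤_          : Rel ℝ 0ℓ
    isTotalOrder : IsTotalOrder _≈_ _≤_
    +-monoʳ-≤    : ∀ x {y z} → y ≤ z → x + y ≤ x + z
    *-nonNeg     : ∀ {x y} → 0# ≤ x → 0# ≤ y → 0# ≤ x * y
    0≉1          : ¬ (0# ≈ 1#)
    -- The value of 0# ⁻¹ is unspecified.
    _⁻¹          : ℝ → ℝ
    *-inverseʳ   : ∀ {x} → ¬ (x ≈ 0#) → x * x ⁻¹ ≈ 1#

  IsUpperBound : (ℝ → Set) → ℝ → Set
  IsUpperBound P u = ∀ x → P x → x ≤ u

  BoundedAbove : (ℝ → Set) → Set
  BoundedAbove P = ∃ (IsUpperBound P)

  IsLeastUpperBound : (ℝ → Set) → ℝ → Set
  IsLeastUpperBound P s = IsUpperBound P s × (∀ u → IsUpperBound P u → s ≤ u)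

  field
    complete : ∀ P → ∃ P → BoundedAbove P → ∃ (IsLeastUpperBound P)

-- The theory is classical, so excluded middle is a parameter; it makes suprema
-- and infima of arbitrary sets total functions.
module MTS (lem : ExcludedMiddle 0ℓ) (R : CompleteOrderedField) where

  open CompleteOrderedField R public
  open ToStrict _≈_ _≤_ public using (_<_)
  open Exp semiring public using (_^_)

  ι : ℕ → ℝ
  ι n = n Mult× 1#
    where open Mult semiring renaming (_×_ to _Mult×_)

  log₂Minorant : ℝ → ℝ → Set
  log₂Minorant x y = ∃ λ p → ∃ λ r → ∃ λ q →
    y ≈ (ι p - ι r) * ι (suc q) ⁻¹ × ι 2 ^ p ≤ ι 2 ^ r * x ^ suc q

  -- log₂ x = sup { m / k | m ∈ ℤ, k ≥ 1, 2 ^ m ≤ x ^ k } for x > 0, with the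
  -- integer m written as p - r. The value for x ≤ 0 is meaningless.
  log₂ : ℝ → ℝ
  log₂ x with lem {∃ (log₂Minorant x) × BoundedAbove (log₂Minorant x)}
  ... | yes (ne , bdd) = proj₁ (complete (log₂Minorant x) ne bdd)
  ... | no _           = 0#

  -- Costs live in ℝ⁺ = ℝ ∪ {+∞}, where +∞ is written ⊤⁺.
  ℝ⁺ : Set
  ℝ⁺ = ℝ ⁺

  open AddSupremum _≤_ public using (_≤⁺_; [_]; _≤⊤⁺)

  infixl 6 _+⁺_
  infixl 7 _*⁺_

  _+⁺_ : ℝ⁺ → ℝ⁺ → ℝ⁺
  [ x ] +⁺ [ y ] = [ x + y ]
  [ x ] +⁺ ⊤⁺    = ⊤⁺
  ⊤⁺    +⁺ _     = ⊤⁺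

  -- Only meaningful for a positive real factor.
  _*⁺_ : ℝ → ℝ⁺ → ℝ⁺
  a *⁺ [ x ] = [ a * x ]
  a *⁺ ⊤⁺    = ⊤⁺

  sup : (P : ℝ → Set) → ∃ P → ℝ⁺
  sup P ne with lem {BoundedAbove P}
  ... | yes bdd = [ proj₁ (complete P ne bdd) ]
  ... | no _    = ⊤⁺

  IsLowerBound : {I : Set} → (I → ℝ⁺) → ℝ → Set
  IsLowerBound f y = ∀ i → [ y ] ≤⁺ f i

  -- The greatest lower bound of a family; +∞ if all members are +∞.
  inf : {I : Set} (f : I → ℝ⁺) → ∃ (IsLowerBound f) → ℝ⁺
  inf f bdd = sup (IsLowerBound f) bdd

  -- Σ_{t ≥ 0} f t as the supremum of the partial sums, for nonnegative f.
  partialSum : (ℕ → ℝ) → ℕ → ℝ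
  partialSum f zero    = 0#
  partialSum f (suc T) = partialSum f T + f T

  series : (ℕ → ℝ) → ℝ⁺
  series f = sup (λ x → ∃ λ T → x ≈ partialSum f T) (0# , 0 , refl)

  series-nonNeg : ∀ f → [ 0# ] ≤⁺ series f
  series-nonNeg f with lem {BoundedAbove (λ x → ∃ λ T → x ≈ partialSum f T)}
  ... | no _    = [ 0# ] ≤⊤⁺
  ... | yes bdd with complete _ (0# , 0 , refl) bdd
  ...   | _ , ub , _ = [ ub 0# (0 , refl) ]

  record FiniteMetricSpace (n : ℕ) : Set₁ where
    field
      Point       : Set
      enumeration : Fin n ↔ Point
      d           : Point → Point → ℝ
      isMetric    : IsGeneralMetric _≡_ _≈_ _≤_ 0# _+_ d

  IsUniform : ∀ {n} → FiniteMetricSpace n → Set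
  IsUniform M = ∀ x y → x ≢ y → d x y ≈ 1#
    where open FiniteMetricSpace M

  module _ {n : ℕ} (M : FiniteMetricSpace n) where
    open FiniteMetricSpace M

    CostVector : Set
    CostVector = Point → ∃ λ (x : ℝ) → 0# ≤ x

    _≋_ : CostVector → CostVector → Set
    u ≋ v = ∀ x → proj₁ (u x) ≈ proj₁ (v x)

    -- c t is the cost vector of time t + 1, so that the entries revealed by
    -- time t are applyUpTo c t = [c 0, …, c (t - 1)].
    CostSequence : Set
    CostSequence = ℕ → CostVector

    Cost : (ℕ → Point) → CostSequence → ℝ⁺
    Cost ρ c = series λ t → d (ρ t) (ρ (suc t)) + proj₁ (c t (ρ (suc t)))

    OPT : CostSequence → ℝ⁺
    OPT c = inf (λ ρ → Cost ρ c) (0# , λ ρ → series-nonNeg _)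

    -- Algorithms are functions of real numbers, hence respect _≈_.
    record Algorithm (Seed : Set) : Set where
      field
        state      : List CostVector → Seed → Point
        state-cong : ∀ {cs cs′} → Pointwise _≋_ cs cs′ →
                     ∀ s → state cs s ≡ state cs′ s

      output : CostSequence → Seed → ℕ → Point
      output c s t = state (applyUpTo c t) s

    -- The seed is uniform on a set with 2 ^ b elements.
    BitAlgorithm : ℕ → Set
    BitAlgorithm b = Algorithm (Fin (2 ℕ.^ b))

  𝔼 : ∀ b → (Fin (2 ℕ.^ b) → ℝ⁺) → ℝ⁺
  𝔼 b f = ι (2 ℕ.^ b) ⁻¹ *⁺ foldr _+⁺_ [ 0# ] f

  -- For α > 0.
  IsCompetitive : ∀ {n} (M : FiniteMetricSpace n) (b : ℕ) →
                  ℝ → BitAlgorithm M b → Set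
  IsCompetitive M b α A = ∃ λ (β : ℝ) → ∀ (c : CostSequence M) →
    𝔼 b (λ s → Cost M (output c s) c) ≤⁺ α *⁺ OPT M c +⁺ [ β ]
    where open Algorithm A

{-# OPTIONS --safe #-}
module Submission where

-- (i) Fixing one seed costs a factor 2^b in the competitive ratio, and a
-- deterministic algorithm is at best n-competitive: an adversary that keeps
-- charging a small cost at its current state makes it pay at every step, while
-- the n static schedules pay, together, only once per step. Hence
-- n ≤ 2^b C log² n.
--
-- (ii) The 2^⌈log n⌉ seeds act as a team of deterministic agents, whose average
-- cost is the expected cost. In each phase, a state is saturated once its
-- accumulated cost is at least 1; the agents on saturated states are moved to
-- unsaturated ones so that the loads stay balanced. With m ≥ n agents and u
-- unsaturated states each load is at most 2m/u, so a phase takes O(m log n)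
-- moves. An agent pays at most 1 at each state it visits, and every schedule
-- pays at least 1 in a phase that has saturated all states.

open import Algebra.Bundles using (CommutativeRing)
open import Axiom.ExcludedMiddle using (ExcludedMiddle)
open import Data.Fin.Base using (Fin; zero; suc; fromℕ<)
open import Data.Fin.Subset using (Subset; _∈_; _⊆_; ∣_∣; Nonempty)
open import Data.Fin.Subset.Properties using (nonempty?; ∣p∣≤n; x∈p⇒∣p-x∣<∣p∣; p⊆q⇒∣p∣≤∣q∣)
open import Data.List.Base using (List; []; _∷_; _∷ʳ_; applyUpTo; foldl)
open import Data.List.Properties using (applyUpTo-∷ʳ; foldl-∷ʳ)
open import Data.List.Relation.Binary.Pointwise.Base using (Pointwise; []; _∷_)
open import Data.Maybe.Base using (Maybe; just; nothing)
open import Data.Nat.Base as ℕ using (ℕ; zero; suc)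
open import Data.Nat.Logarithm using (⌈log₂_⌉)
open import Data.Product.Base using (∃; _×_; _,_; proj₁; proj₂)
open import Data.Sum.Base using (_⊎_; inj₁; inj₂)
open import Data.Vec.Base using (Vec; []; _∷_; map; lookup; replicate)
open import Data.Vec.Functional using (foldr)
open import Data.Vec.Properties using (lookup-map; lookup-replicate)
open import Function.Base using (_∘_)
open import Function.Bundles using (Inverse; mk⇔)
open import Function.Metric.Structures using (IsGeneralMetric)
open import Level using (0ℓ)
open import Relation.Binary.Bundles using (Poset)
open import Relation.Binary.PropositionalEquality.Core as ≡ using (_≡_; _≢_)
open import Relation.Binary.Structures using (IsTotalOrder)
open import Relation.Nullary using (¬_; Dec; yes; no)
open import Relation.Nullary.Construct.Add.Supremum using ([_]; ⊤⁺)
open import Relation.Nullary.Negation using (contradiction)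
open import Defs
import Data.Nat.Properties as ℕ
import Relation.Binary.Construct.Add.Supremum.NonStrict as AddSupremum

-- In (i) the charge is a positive lower bound e of the distances, so that leaving and staying both
-- cost the fixed seed at least e. Requests stop at a horizon T, which keeps `OPT` finite; as T
-- grows, the additive constant disappears. In (ii) the obstacle is the cost vector that ends a
-- phase: it may be arbitrarily large and has to be paid somewhere. All agents answer it at a
-- cheapest state, at a price μ, and the phase is charged 1 + μ rather than 1. Twice the cost of any
-- schedule meets this charge: a single entry may have to account both for the saturation of its
-- state and for μ. Moves are paid from a potential: the vacant agents plus the quotas, about m/u,
-- summed over all u up to the number of unsaturated states. Costs at states are paid from a credit,
-- the accumulated cost at an agent's state: it is at most 1 and is lost when the agent leaves.
-- Hence a move is worth 2, one for the distance and one for the lost credit. An algorithm has to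
-- respect `_≈_`, so each choice is the first element of a subset that depends only on the truth of
-- real inequalities.

module Assignments where

  open import Data.Bool.Base using (if_then_else_)
  open import Data.Fin.Properties using (_≟_; any?)
  open import Data.Fin.Subset using (inside; outside; _─_; _∩_)
  open import Data.Fin.Subset.Properties using (_∈?_; drop-∷-⊆; x∈p∧x∉q⇒x∈p─q; p─q⊆p; x∈p∩q⁺; x∈p∩q⁻)
  open import Data.Nat.Base
    using (_+_; _*_; _∸_; _≤_; _<_; z≤n; s≤s; NonZero; ⌊_/2⌋; ⌈_/2⌉)
  open import Data.Nat.DivMod using (_/_; _%_; m≡m%n+[m/n]*n; m%n<n; m/n*n≤m; n/1≡n; /-monoʳ-≤)
  open import Data.Nat.Induction using (<-wellFounded)
  open import Data.Nat.Logarithm using (⌈log₂⌉-mono-≤)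
  open import Data.Nat.Logarithm.Core using (⌈log2⌉)
  open import Data.Nat.Properties hiding (_≟_)
  open import Data.Nat.Solver using (module +-*-Solver)
  open import Data.Vec.Base using (tabulate; here; there)
  open import Data.Vec.Properties using (lookup∘tabulate; tabulate-cong; []=⇒lookup; lookup⇒[]=)
  open import Function.Bundles using (_⇔_)
  open import Induction.WellFounded using (Acc; acc)
  open import Relation.Binary.PropositionalEquality
    using (_≡_; _≢_; refl; sym; trans; cong)
  open import Relation.Nullary using (does)
  open import Relation.Nullary.Decidable using (_×-dec_; dec-true; does-⇔)
  open +-*-Solver using (solve; _:+_; _:*_; _:=_; con)

  private
    variable
      n k : ℕ

  -- Sums over subsets and canonical choices

  sumOver : Subset n → (Fin n → ℕ) → ℕ
  sumOver []            f = 0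
  sumOver (inside  ∷ p) f = f zero + sumOver p (f ∘ suc)
  sumOver (outside ∷ p) f = sumOver p (f ∘ suc)

  sumOver-+ : ∀ (p : Subset n) f g →
              sumOver p (λ x → f x + g x) ≡ sumOver p f + sumOver p g
  sumOver-+ []            f g = refl
  sumOver-+ (inside  ∷ p) f g = trans
    (cong (f zero + g zero +_) (sumOver-+ p (f ∘ suc) (g ∘ suc)))
    (solve 4 (λ a b c d → a :+ b :+ (c :+ d) := a :+ c :+ (b :+ d)) refl
      (f zero) (g zero) _ _)
  sumOver-+ (outside ∷ p) f g = sumOver-+ p (f ∘ suc) (g ∘ suc)

  sumOver-0 : ∀ (p : Subset n) → sumOver p (λ _ → 0) ≡ 0
  sumOver-0 []            = refl
  sumOver-0 (inside  ∷ p) = sumOver-0 p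
  sumOver-0 (outside ∷ p) = sumOver-0 p

  sumOver-≤ : ∀ (p : Subset n) {f L} → (∀ x → x ∈ p → f x ≤ L) →
              sumOver p f ≤ ∣ p ∣ * L
  sumOver-≤ []            f≤L = z≤n
  sumOver-≤ (inside  ∷ p) f≤L =
    +-mono-≤ (f≤L zero here) (sumOver-≤ p (λ x x∈p → f≤L (suc x) (there x∈p)))
  sumOver-≤ (outside ∷ p) f≤L = sumOver-≤ p (λ x x∈p → f≤L (suc x) (there x∈p))

  sumOver-≥ : ∀ (p : Subset n) {f L} → (∀ x → x ∈ p → L ≤ f x) →
              ∣ p ∣ * L ≤ sumOver p f
  sumOver-≥ []            L≤f = z≤n
  sumOver-≥ (inside  ∷ p) L≤f =
    +-mono-≤ (L≤f zero here) (sumOver-≥ p (λ x x∈p → L≤f (suc x) (there x∈p)))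
  sumOver-≥ (outside ∷ p) L≤f = sumOver-≥ p (λ x x∈p → L≤f (suc x) (there x∈p))

  δ : Fin n → Fin n → ℕ
  δ zero    zero    = 1
  δ zero    (suc x) = 0
  δ (suc y) zero    = 0
  δ (suc y) (suc x) = δ y x

  δ-refl : ∀ (x : Fin n) → δ x x ≡ 1
  δ-refl zero    = refl
  δ-refl (suc x) = δ-refl x

  δ-≢ : ∀ {x y : Fin n} → x ≢ y → δ x y ≡ 0
  δ-≢ {x = zero}  {zero}  x≢y = contradiction refl x≢y
  δ-≢ {x = zero}  {suc y} x≢y = refl
  δ-≢ {x = suc x} {zero}  x≢y = refl
  δ-≢ {x = suc x} {suc y} x≢y = δ-≢ (x≢y ∘ cong suc)

  sumOver-δ-∈ : ∀ {p : Subset n} {y} → y ∈ p → sumOver p (δ y) ≡ 1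
  sumOver-δ-∈ {p = _ ∷ p}       here        = cong suc (sumOver-0 p)
  sumOver-δ-∈ {p = inside  ∷ p} (there y∈p) = sumOver-δ-∈ y∈p
  sumOver-δ-∈ {p = outside ∷ p} (there y∈p) = sumOver-δ-∈ y∈p

  sumOver-δ≤1 : ∀ (p : Subset n) y → sumOver p (δ y) ≤ 1
  sumOver-δ≤1 (inside  ∷ p) zero    = ≤-reflexive (cong suc (sumOver-0 p))
  sumOver-δ≤1 (outside ∷ p) zero    = ≤-trans (≤-reflexive (sumOver-0 p)) z≤n
  sumOver-δ≤1 (inside  ∷ p) (suc y) = sumOver-δ≤1 p y
  sumOver-δ≤1 (outside ∷ p) (suc y) = sumOver-δ≤1 p y

  ∣p─q∣+∣q∣≡∣p∣ : ∀ (p q : Subset n) → q ⊆ p → ∣ p ─ q ∣ + ∣ q ∣ ≡ ∣ p ∣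
  ∣p─q∣+∣q∣≡∣p∣ []            []            q⊆p = refl
  ∣p─q∣+∣q∣≡∣p∣ (inside  ∷ p) (inside  ∷ q) q⊆p =
    trans (+-suc _ _) (cong suc (∣p─q∣+∣q∣≡∣p∣ p q (drop-∷-⊆ q⊆p)))
  ∣p─q∣+∣q∣≡∣p∣ (inside  ∷ p) (outside ∷ q) q⊆p = cong suc (∣p─q∣+∣q∣≡∣p∣ p q (drop-∷-⊆ q⊆p))
  ∣p─q∣+∣q∣≡∣p∣ (outside ∷ p) (outside ∷ q) q⊆p = ∣p─q∣+∣q∣≡∣p∣ p q (drop-∷-⊆ q⊆p)
  ∣p─q∣+∣q∣≡∣p∣ (outside ∷ p) (inside  ∷ q) q⊆p with q⊆p here
  ... | ()

  module _ {P : Fin n → Set} (P? : ∀ x → Dec (P x)) where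

    comprehension : Subset n
    comprehension = tabulate (does ∘ P?)

    ∈-comprehension⁺ : ∀ {x} → P x → x ∈ comprehension
    ∈-comprehension⁺ {x} Px =
      lookup⇒[]= x _ (trans (lookup∘tabulate _ x) (dec-true (P? x) Px))

    ∈-comprehension⁻ : ∀ {x} → x ∈ comprehension → P x
    ∈-comprehension⁻ {x} x∈ with P? x | trans (sym (lookup∘tabulate (does ∘ P?) x)) ([]=⇒lookup x∈)
    ... | yes Px | _ = Px

  -- Only the truth values enter the vector, so deciders obtained from excluded middle are harmless.
  -- Choices made from comparisons of reals thus do not depend on representatives, which
  -- `state-cong` demands.
  comprehension-cong : ∀ {P Q : Fin n → Set} (P? : ∀ x → Dec (P x)) (Q? : ∀ x → Dec (Q x)) →
                       (∀ x → P x ⇔ Q x) → comprehension P? ≡ comprehension Q?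
  comprehension-cong P? Q? P⇔Q = tabulate-cong (λ x → does-⇔ (P⇔Q x) (P? x) (Q? x))

  -- The value on the empty set is junk.
  first : Subset (suc n) → Fin (suc n)
  first {zero}  p             = zero
  first {suc n} (inside  ∷ p) = zero
  first {suc n} (outside ∷ p) = suc (first p)

  first-∈ : ∀ (p : Subset (suc n)) → Nonempty p → first p ∈ p
  first-∈ {zero}  p             (zero , 0∈p)       = 0∈p
  first-∈ {suc n} (inside  ∷ p) _                  = here
  first-∈ {suc n} (outside ∷ p) (suc x , there x∈) = there (first-∈ p (x , x∈))

  -- An agent is at a point, or vacant, i.e. yet to be assigned one.
  Assignment : ℕ → ℕ → Set
  Assignment n k = Vec (Maybe (Fin n)) k

  -- Loads and vacancies of assignments

  load : Assignment n k → Fin n → ℕ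
  load []             x = 0
  load (nothing ∷ v) x = load v x
  load (just y  ∷ v) x = δ y x + load v x

  vacant : Assignment n k → ℕ
  vacant []             = 0
  vacant (nothing ∷ v) = suc (vacant v)
  vacant (just y  ∷ v) = vacant v

  _Within_ : Assignment n k → Subset n → Set
  v Within p = ∀ i {x} → lookup v i ≡ just x → x ∈ p

  keep : Subset n → Maybe (Fin n) → Maybe (Fin n)
  keep p nothing  = nothing
  keep p (just x) = if does (x ∈? p) then just x else nothing

  keep-just : ∀ (p : Subset n) a {x} → keep p a ≡ just x → a ≡ just x × x ∈ p
  keep-just p (just y) eq with y ∈? p
  keep-just p (just y) refl | yes y∈p = refl , y∈p

  sumOver-load : ∀ (p : Subset n) (v : Assignment n k) → sumOver p (load v) ≤ k
  sumOver-load p []            = ≤-reflexive (sumOver-0 p)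
  sumOver-load p (nothing ∷ v) = m≤n⇒m≤1+n (sumOver-load p v)
  sumOver-load p (just y  ∷ v) = ≤-trans
    (≤-reflexive (sumOver-+ p (δ y) (load v)))
    (+-mono-≤ (sumOver-δ≤1 p y) (sumOver-load p v))

  load-keep : ∀ (p : Subset n) (v : Assignment n k) x →
              load (map (keep p) v) x ≤ load v x
  load-keep p []            x = z≤n
  load-keep p (nothing ∷ v) x = load-keep p v x
  load-keep p (just y  ∷ v) x with y ∈? p
  ... | yes _ = +-monoʳ-≤ (δ y x) (load-keep p v x)
  ... | no  _ = ≤-trans (load-keep p v x) (m≤n+m _ (δ y x))

  -- The agents that lose their place stand in `p` but not in `q`, and the load there counts them;
  -- `Within` excludes agents elsewhere.
  vacant-keep : ∀ (p q : Subset n) (v : Assignment n k) → v Within p →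
                vacant (map (keep q) v) ≤ vacant v + sumOver (p ─ q) (load v)
  vacant-keep p q []            v⊆p = z≤n
  vacant-keep p q (nothing ∷ v) v⊆p = s≤s (vacant-keep p q v (v⊆p ∘ suc))
  vacant-keep p q (just y  ∷ v) v⊆p
    with y ∈? q | sumOver-+ (p ─ q) (δ y) (load v) | vacant-keep p q v (v⊆p ∘ suc)
  ... | yes _   | eq | ih = ≤-trans ih
    (+-monoʳ-≤ (vacant v) (≤-trans (m≤n+m _ (sumOver (p ─ q) (δ y))) (≤-reflexive (sym eq))))
  ... | no  y∉q | eq | ih = ≤-trans (s≤s ih) (≤-reflexive (sym (trans
    (cong (vacant v +_) (trans eq (cong (_+ sumOver (p ─ q) (load v))
      (sumOver-δ-∈ (x∈p∧x∉q⇒x∈p─q (v⊆p zero refl) y∉q)))))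
    (+-suc (vacant v) _))))

  -- Quotas and the number of moves in a phase

  -- For positive m and u this is m/u rounded up, the least load bound under which m agents fit on u
  -- points.
  quota : ℕ → ℕ → ℕ
  quota m zero    = 0
  quota m (suc u) = suc ((m ∸ 1) / suc u)

  -- Bounds the number of moves in a phase during which the number of
  -- unsaturated states decreases from u to 0.
  moveBound : ℕ → ℕ → ℕ
  moveBound m zero    = 0
  moveBound m (suc u) = quota m (suc u) + moveBound m u

  module _ (m : ℕ) where

    quota-capacity : ∀ u → .{{NonZero u}} → m ≤ u * quota m u
    quota-capacity (suc u) = begin
      m                                        ≤⟨ m≤n+m∸n m 1 ⟩
      1 + (m ∸ 1)                              ≡⟨ cong suc (m≡m%n+[m/n]*n (m ∸ 1) (suc u)) ⟩
      suc ((m ∸ 1) % suc u) + (m ∸ 1) / suc u * suc u ≤⟨ +-monoˡ-≤ _ (m%n<n (m ∸ 1) (suc u)) ⟩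
      suc u + (m ∸ 1) / suc u * suc u          ≡⟨ cong (suc u +_) (*-comm ((m ∸ 1) / suc u) (suc u)) ⟩
      suc u + suc u * ((m ∸ 1) / suc u)        ≡⟨ *-suc (suc u) _ ⟨
      suc u * quota m (suc u)                  ∎
      where open ≤-Reasoning

    *-quota-≤ : ∀ u → u * quota m u ≤ u + m
    *-quota-≤ zero    = z≤n
    *-quota-≤ (suc u) = begin
      suc u * quota m (suc u)            ≡⟨ *-suc (suc u) _ ⟩
      suc u + suc u * ((m ∸ 1) / suc u)  ≡⟨ cong (suc u +_) (*-comm (suc u) ((m ∸ 1) / suc u)) ⟩
      suc u + (m ∸ 1) / suc u * suc u    ≤⟨ +-monoʳ-≤ (suc u) (m/n*n≤m (m ∸ 1) (suc u)) ⟩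
      suc u + (m ∸ 1)                    ≤⟨ +-monoʳ-≤ (suc u) (m∸n≤m m 1) ⟩
      suc u + m                          ∎
      where open ≤-Reasoning

    quota-antitone : ∀ {u v} → .{{NonZero u}} → u ≤ v → quota m v ≤ quota m u
    quota-antitone {suc u} {suc v} u≤v = s≤s (/-monoʳ-≤ (m ∸ 1) u≤v)

    -- When `j` states become saturated at once, each vacates at most the quota in force before.
    -- Quotas grow as the number of unsaturated states falls, so this is no worse than losing the
    -- states one by one.
    moveBound-≥ : ∀ j u → j * quota m (j + u) + moveBound m u ≤ moveBound m (j + u)
    moveBound-≥ zero          u = ≤-refl
    -- Treated apart because `quota-antitone` wants a positive argument, and for j = 1 the smaller
    -- one is `u`, possibly 0.
    moveBound-≥ (suc zero)    u = ≤-reflexive (cong (_+ moveBound m u) (*-identityˡ _))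
    moveBound-≥ (suc j@(suc _)) u = begin
      q + j * q + moveBound m u                    ≡⟨ +-assoc q _ _ ⟩
      q + (j * q + moveBound m u)                  ≤⟨ +-monoʳ-≤ q (+-monoˡ-≤ _
                                                       (*-monoʳ-≤ j (quota-antitone (n≤1+n (j + u))))) ⟩
      q + (j * quota m (j + u) + moveBound m u)    ≤⟨ +-monoʳ-≤ q (moveBound-≥ j u) ⟩
      q + moveBound m (j + u)                      ∎
      where
      open ≤-Reasoning
      q = quota m (suc j + u)

    moveBound-mono : ∀ {u v} → u ≤ v → moveBound m u ≤ moveBound m v
    moveBound-mono {u} {v} u≤v = begin
      moveBound m u                                          ≤⟨ m≤n+m _ ((v ∸ u) * quota m (v ∸ u + u)) ⟩
      (v ∸ u) * quota m (v ∸ u + u) + moveBound m u          ≤⟨ moveBound-≥ (v ∸ u) u ⟩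
      moveBound m (v ∸ u + u)                                ≡⟨ cong (moveBound m) (m∸n+n≡m u≤v) ⟩
      moveBound m v                                          ∎
      where open ≤-Reasoning

    moveBound-≤ : ∀ j u → .{{NonZero u}} → moveBound m (j + u) ≤ j * quota m u + moveBound m u
    moveBound-≤ zero    u = ≤-refl
    moveBound-≤ (suc j) u = begin
      quota m (suc j + u) + moveBound m (j + u)         ≤⟨ +-mono-≤ (quota-antitone (m≤n+m u (suc j)))
                                                                    (moveBound-≤ j u) ⟩
      quota m u + (j * quota m u + moveBound m u)       ≡⟨ +-assoc (quota m u) _ _ ⟨
      suc j * quota m u + moveBound m u                 ∎
      where open ≤-Reasoning

    -- The dyadic estimate of a harmonic sum: the quotas between j = 2^k and 2j are at most the one
    -- at j, so together at most j + m, and j ≤ m makes that at most 2m per doubling.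
    moveBound-2^ : ∀ k → 2 ℕ.^ k ≤ m → moveBound m (2 ℕ.^ k) ≤ m + k * (2 * m)
    moveBound-2^ zero    1≤m = ≤-reflexive (cong (_+ 0) (trans
      (cong suc (n/1≡n (m ∸ 1))) (m+[n∸m]≡n 1≤m)))
    moveBound-2^ (suc k) 2^k≤m = begin
      moveBound m (j + (j + 0))               ≡⟨ cong (λ i → moveBound m (j + i)) (+-identityʳ j) ⟩
      moveBound m (j + j)                     ≤⟨ moveBound-≤ j j {{m^n≢0 2 k}} ⟩
      j * quota m j + moveBound m j           ≤⟨ +-mono-≤ (*-quota-≤ j) (moveBound-2^ k j≤m) ⟩
      j + m + (m + k * (2 * m))               ≤⟨ +-monoˡ-≤ _ (+-monoˡ-≤ m j≤m) ⟩
      m + m + (m + k * (2 * m))               ≡⟨ solve 2 (λ m k → m :+ m :+ (m :+ k :* (con 2 :* m))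
                                                   := m :+ (con 2 :* m :+ k :* (con 2 :* m))) refl m k ⟩
      m + suc k * (2 * m)                     ∎
      where
      open ≤-Reasoning
      j = 2 ℕ.^ k
      j≤m = ≤-trans (m≤m+n j _) 2^k≤m

    -- The potential for moves: what saturation adds to the vacancies, it takes from `moveBound`.
    -- The load bound is what keeps the newly vacant agents few.
    vacant-keep-moveBound :
      ∀ (p q : Subset n) (v : Assignment n k) → v Within p → q ⊆ p →
      (∀ x → x ∈ p → load v x ≤ quota m ∣ p ∣) →
      vacant (map (keep q) v) + moveBound m ∣ q ∣ ≤ vacant v + moveBound m ∣ p ∣
    vacant-keep-moveBound p q v v⊆p q⊆p load≤ = begin
      vacant (map (keep q) v) + w ∣ q ∣                    ≤⟨ +-monoˡ-≤ _ (vacant-keep p q v v⊆p) ⟩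
      vacant v + sumOver (p ─ q) (load v) + w ∣ q ∣        ≡⟨ +-assoc (vacant v) _ _ ⟩
      vacant v + (sumOver (p ─ q) (load v) + w ∣ q ∣)      ≤⟨ +-monoʳ-≤ (vacant v) (+-monoˡ-≤ _
                                                               (sumOver-≤ (p ─ q) λ x x∈ → load≤ x (p─q⊆p p q x∈))) ⟩
      vacant v + (∣ p ─ q ∣ * quota m ∣ p ∣ + w ∣ q ∣)     ≡⟨ cong (λ i → vacant v + (∣ p ─ q ∣ * quota m i + w ∣ q ∣)) (sym eq) ⟩
      vacant v + (∣ p ─ q ∣ * quota m (∣ p ─ q ∣ + ∣ q ∣) + w ∣ q ∣)
                                                           ≤⟨ +-monoʳ-≤ (vacant v) (moveBound-≥ ∣ p ─ q ∣ ∣ q ∣) ⟩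
      vacant v + w (∣ p ─ q ∣ + ∣ q ∣)                     ≡⟨ cong (λ i → vacant v + w i) eq ⟩
      vacant v + w ∣ p ∣                                   ∎
      where
      open ≤-Reasoning
      w = moveBound m
      eq = ∣p─q∣+∣q∣≡∣p∣ p q q⊆p

  -- Placing the vacant agents

  pick : Subset (suc n) → (Fin (suc n) → ℕ) → ℕ → Fin (suc n)
  pick p ℓ L = first (p ∩ comprehension (λ x → ℓ x <? L))

  pick-∈ : ∀ (p : Subset (suc n)) ℓ L → (∃ λ x → x ∈ p × ℓ x < L) →
           pick p ℓ L ∈ p × ℓ (pick p ℓ L) < L
  pick-∈ p ℓ L (x , x∈p , ℓx<L) = proj₁ y∈ , ∈-comprehension⁻ below? (proj₂ y∈)
    where
    below? = λ x → ℓ x <? L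
    y∈ = x∈p∩q⁻ p _ (first-∈ _ (x , x∈p∩q⁺ (x∈p , ∈-comprehension⁺ below? ℓx<L)))

  -- The vacant agents are placed one after the other, each at some point of p
  -- whose load is still below L; e is the load due to the agents already treated.
  fill : Subset (suc n) → ℕ → (Fin (suc n) → ℕ) → Assignment (suc n) k → Vec (Fin (suc n)) k
  fill p L e []            = []
  fill p L e (just y  ∷ v) = y ∷ fill p L (λ x → e x + δ y x) v
  fill p L e (nothing ∷ v) = y ∷ fill p L (λ x → e x + δ y x) v
    where y = pick p (λ x → e x + load v x) L

  record IsFilling (p : Subset n) (L : ℕ) (e : Fin n → ℕ)
                   (v : Assignment n k) (w : Vec (Fin n) k) : Set where
    field
      within   : ∀ i → lookup w i ∈ p
      load≤    : ∀ x → x ∈ p → e x + load (map just w) x ≤ L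
      unmoved  : ∀ i {x} → lookup v i ≡ just x → lookup w i ≡ x

  -- Room never runs out: `e` counts the agents already treated and the length of the vector those
  -- still to come, vacant or not. If no point of `p` were below `L`, the load on `p` would reach
  -- `∣ p ∣ * L`, yet the agent to be placed is not part of it, so it stays strictly below the
  -- capacity.
  fill-isFilling : ∀ (p : Subset (suc n)) L e (v : Assignment (suc n) k) → v Within p →
                   (∀ x → x ∈ p → e x + load v x ≤ L) → sumOver p e + k ≤ ∣ p ∣ * L →
                   IsFilling p L e v (fill p L e v)
  fill-isFilling p L e [] v⊆p load≤ cap = record
    { within = λ (); load≤ = load≤ ; unmoved = λ () }
  fill-isFilling {k = suc k} p L e (a ∷ v) v⊆p load≤ cap = go a refl
    where
    place : ∀ y → y ∈ p → (∀ {x} → a ≡ just x → y ≡ x) →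
            (∀ x → x ∈ p → e x + (δ y x + load v x) ≤ L) →
            IsFilling p L e (a ∷ v) (y ∷ fill p L (λ x → e x + δ y x) v)
    place y y∈p y-unmoved load≤′ = record
      { within  = λ { zero → y∈p ; (suc i) → within i }
      ; load≤   = λ x x∈p → ≤-trans (≤-reflexive (sym (+-assoc (e x) (δ y x) _))) (IsFilling.load≤ ih x x∈p)
      ; unmoved = λ { zero → y-unmoved ; (suc i) → unmoved i }
      }
      where
      ih = fill-isFilling p L (λ x → e x + δ y x) v (v⊆p ∘ suc)
        (λ x x∈p → ≤-trans (≤-reflexive (+-assoc (e x) (δ y x) _)) (load≤′ x x∈p))
        (≤-trans (≤-reflexive (trans
          (cong (_+ k) (trans (sumOver-+ p e (δ y)) (cong (sumOver p e +_) (sumOver-δ-∈ y∈p))))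
          (+-assoc (sumOver p e) 1 k))) cap)
      open IsFilling ih

    go : ∀ b → a ≡ b → IsFilling p L e (a ∷ v) (fill p L e (a ∷ v))
    go (just y) refl = place y (v⊆p zero refl) (λ { refl → refl }) load≤
    go nothing  refl = place y (proj₁ y-spec) (λ ()) load≤′
      where
      ℓ = λ x → e x + load v x
      y = pick p ℓ L

      free : ∃ λ x → x ∈ p × ℓ x < L
      free with any? (λ x → (x ∈? p) ×-dec (ℓ x <? L))
      ... | yes found = found
      ... | no  none  = contradiction cap (<⇒≱ (begin-strict
        ∣ p ∣ * L                       ≤⟨ sumOver-≥ p (λ x x∈p → ≮⇒≥ (λ ℓx<L → none (x , x∈p , ℓx<L))) ⟩
        sumOver p ℓ                     ≡⟨ sumOver-+ p e (load v) ⟩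
        sumOver p e + sumOver p (load v) ≤⟨ +-monoʳ-≤ (sumOver p e) (sumOver-load p v) ⟩
        sumOver p e + k                 <⟨ +-monoʳ-< (sumOver p e) (n<1+n k) ⟩
        sumOver p e + suc k             ∎))
        where open ≤-Reasoning

      y-spec = pick-∈ p ℓ L free

      load≤′ : ∀ x → x ∈ p → e x + (δ y x + load v x) ≤ L
      load≤′ x x∈p with x ≟ y
      ... | yes refl = ≤-trans (≤-reflexive (trans (cong (λ i → e x + (i + load v x)) (δ-refl x))
                         (+-suc (e x) (load v x)))) (proj₂ y-spec)
      ... | no  x≢y  = ≤-trans (≤-reflexive (cong (λ i → e x + (i + load v x)) (δ-≢ (x≢y ∘ sym))))
                         (load≤ x x∈p)

  -- Rounded logarithms of natural numbers

  n≤2^⌈log2⌉ : ∀ n (ac : Acc _<_ n) → n ≤ 2 ℕ.^ ⌈log2⌉ n ac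
  n≤2^⌈log2⌉ 0             ac       = z≤n
  n≤2^⌈log2⌉ 1             ac       = ≤-refl
  n≤2^⌈log2⌉ (suc (suc n)) (acc rs) = begin
    2 + n                     ≡⟨ ⌊n/2⌋+⌈n/2⌉≡n (2 + n) ⟨
    ⌊ 2 + n /2⌋ + ⌈ 2 + n /2⌉ ≤⟨ +-monoˡ-≤ _ (⌊n/2⌋≤⌈n/2⌉ (2 + n)) ⟩
    h + h                     ≡⟨ cong (h +_) (+-identityʳ h) ⟨
    2 * h                     ≤⟨ *-monoʳ-≤ 2 (n≤2^⌈log2⌉ h _) ⟩
    2 ℕ.^ ⌈log2⌉ (2 + n) (acc rs) ∎
    where
    open ≤-Reasoning
    h = ⌈ 2 + n /2⌉

  -- For N = 2 + n the bound is 2(N - 1): a bound 2N would not survive the halving, which rounds up,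
  -- whereas 2(⌈N/2⌉ - 1) ≤ N - 1 does.
  2^⌈log2⌉≤ : ∀ n (ac : Acc _<_ (2 + n)) → 2 ℕ.^ ⌈log2⌉ (2 + n) ac ≤ 2 * (1 + n)
  2^⌈log2⌉≤ 0             (acc rs) = ≤-refl
  2^⌈log2⌉≤ 1             (acc rs) = *-monoʳ-≤ 2 (2^⌈log2⌉≤ 0 (rs (⌈n/2⌉<n 1)))
  2^⌈log2⌉≤ (suc (suc n)) (acc rs) =
    *-monoʳ-≤ 2 (≤-trans (2^⌈log2⌉≤ h (rs (⌈n/2⌉<n (suc (suc n))))) (begin
    2 * (1 + h)                ≡⟨ solve 1 (λ h → con 2 :* (con 1 :+ h) := con 2 :+ (h :+ h)) refl h ⟩
    2 + (h + h)                ≤⟨ +-monoʳ-≤ 2 h+h≤ ⟩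
    3 + n                      ∎))
    where
    open ≤-Reasoning
    h = ⌈ n /2⌉
    h+h≤ : h + h ≤ suc n
    h+h≤ = begin
      h + h                    ≤⟨ +-monoˡ-≤ h (⌊n/2⌋-mono (n≤1+n (suc n))) ⟩
      ⌊ 2 + n /2⌋ + h          ≡⟨ cong suc (⌊n/2⌋+⌈n/2⌉≡n n) ⟩
      suc n                    ∎

  n≤2^⌈log₂n⌉ : ∀ n → n ≤ 2 ℕ.^ ⌈log₂ n ⌉
  n≤2^⌈log₂n⌉ n = n≤2^⌈log2⌉ n (<-wellFounded n)

  -- Says ⌈log n⌉ ≤ 2 log n as an inequality between integers, the form in which `log₂` admits lower
  -- bounds.
  2^⌈log₂n⌉≤n*n : ∀ n → 2 ≤ n → 2 ℕ.^ ⌈log₂ n ⌉ ≤ n * n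
  2^⌈log₂n⌉≤n*n (suc zero)      (s≤s ())
  2^⌈log₂n⌉≤n*n n@(suc (suc i)) 2≤n = begin
    2 ℕ.^ ⌈log₂ n ⌉ ≤⟨ 2^⌈log2⌉≤ i (<-wellFounded n) ⟩
    2 * (1 + i)     ≤⟨ *-mono-≤ 2≤n (n≤1+n (1 + i)) ⟩
    n * n           ∎
    where open ≤-Reasoning

  1≤⌈log₂n⌉ : ∀ {n} → 2 ≤ n → 1 ≤ ⌈log₂ n ⌉
  1≤⌈log₂n⌉ 2≤n = ⌈log₂⌉-mono-≤ 2≤n

  -- The cost of a phase, up to its last cost vector: 2 per agent for the end of the phase, and 2
  -- for each pending move at its start. The sum is at most 6m + 4mb, and b ≥ 1 gives 10mb.
  phase-bound : ∀ n → 2 ≤ n → let b = ⌈log₂ n ⌉; m = 2 ℕ.^ b in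
                m * 2 + 2 * (m + moveBound m n) ≤ m * (10 * b)
  phase-bound n 2≤n = begin
    m * 2 + 2 * (m + moveBound m n)       ≤⟨ +-monoʳ-≤ (m * 2) (*-monoʳ-≤ 2 (+-monoʳ-≤ m (≤-trans
                                               (moveBound-mono m (n≤2^⌈log₂n⌉ n)) (moveBound-2^ m b ≤-refl)))) ⟩
    m * 2 + 2 * (m + (m + b * (2 * m)))   ≡⟨ solve 2 (λ m k → m :* con 2 :+ con 2 :* (m :+ (m :+ k :* (con 2 :* m)))
                                               := con 6 :* m :* con 1 :+ con 4 :* m :* k) refl m b ⟩
    6 * m * 1 + 4 * m * b                 ≤⟨ +-monoˡ-≤ (4 * m * b) (*-monoʳ-≤ (6 * m) (1≤⌈log₂n⌉ 2≤n)) ⟩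
    6 * m * b + 4 * m * b                 ≡⟨ solve 2 (λ m k → con 6 :* m :* k :+ con 4 :* m :* k
                                               := m :* (con 10 :* k)) refl m b ⟩
    m * (10 * b)                          ∎
    where
    open ≤-Reasoning
    b = ⌈log₂ n ⌉
    m = 2 ℕ.^ b

open Assignments

-- Arithmetic in the complete ordered field

module OrderedField (lem : ExcludedMiddle 0ℓ) (R : CompleteOrderedField) where
  open MTS lem R
  open import Algebra.Properties.Ring ring using (-‿distribˡ-*; -‿involutive)
  open import Algebra.Properties.Semiring.Mult semiring using (×-homo-+; ×1-homo-*)
  open import Algebra.Properties.Semiring.Exp semiring using (^-homo-*; ^-assocʳ)
  open IsTotalOrder isTotalOrder public
    using (antisym; total) renaming (refl to ≤-refl; trans to ≤-trans; reflexive to ≤-reflexive)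

  poset : Poset 0ℓ 0ℓ 0ℓ
  poset = record { isPartialOrder = IsTotalOrder.isPartialOrder isTotalOrder }

  module ≤-Reasoning where
    open import Relation.Binary.Reasoning.PartialOrder poset public

  open ≤-Reasoning

  x+y-y≈x : ∀ x y → (x + y) - y ≈ x
  x+y-y≈x x y = trans (+-assoc x y (- y)) (trans (+-congˡ (-‿inverseʳ y)) (+-identityʳ x))

  x-y+y≈x : ∀ x y → (x - y) + y ≈ x
  x-y+y≈x x y = trans (+-assoc x (- y) y) (trans (+-congˡ (-‿inverseˡ y)) (+-identityʳ x))

  +-monoˡ-≤ : ∀ z {x y} → x ≤ y → x + z ≤ y + z
  +-monoˡ-≤ z {x} {y} x≤y = begin
    x + z ≈⟨ +-comm x z ⟩
    z + x ≤⟨ +-monoʳ-≤ z x≤y ⟩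
    z + y ≈⟨ +-comm z y ⟩
    y + z ∎

  +-mono-≤ : ∀ {u v x y} → u ≤ v → x ≤ y → u + x ≤ v + y
  +-mono-≤ {v = v} {x = x} u≤v x≤y = ≤-trans (+-monoˡ-≤ x u≤v) (+-monoʳ-≤ v x≤y)

  +-cancelʳ-≤ : ∀ z {x y} → x + z ≤ y + z → x ≤ y
  +-cancelʳ-≤ z {x} {y} le = begin
    x           ≈⟨ x+y-y≈x x z ⟨
    (x + z) - z ≤⟨ +-monoˡ-≤ (- z) le ⟩
    (y + z) - z ≈⟨ x+y-y≈x y z ⟩
    y           ∎

  x≤y+z⇒x-z≤y : ∀ {x y z} → x ≤ y + z → x - z ≤ y
  x≤y+z⇒x-z≤y {x} {y} {z} le = +-cancelʳ-≤ z (≤-trans (≤-reflexive (x-y+y≈x x z)) le)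

  x≤y-z⇒x+z≤y : ∀ {x y z} → x ≤ y - z → x + z ≤ y
  x≤y-z⇒x+z≤y {x} {y} {z} le = ≤-trans (+-monoˡ-≤ z le) (≤-reflexive (x-y+y≈x y z))

  x+z≤y⇒x≤y-z : ∀ {x y z} → x + z ≤ y → x ≤ y - z
  x+z≤y⇒x≤y-z {x} {y} {z} le = +-cancelʳ-≤ z (≤-trans le (≤-reflexive (sym (x-y+y≈x y z))))

  +-nonNeg : ∀ {x y} → 0# ≤ x → 0# ≤ y → 0# ≤ x + y
  +-nonNeg 0≤x 0≤y = ≤-trans (≤-reflexive (sym (+-identityʳ 0#))) (+-mono-≤ 0≤x 0≤y)

  x≤x+y : ∀ x {y} → 0# ≤ y → x ≤ x + y
  x≤x+y x 0≤y = ≤-trans (≤-reflexive (sym (+-identityʳ x))) (+-monoʳ-≤ x 0≤y)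

  y≤x+y : ∀ {x} y → 0# ≤ x → y ≤ x + y
  y≤x+y y 0≤x = ≤-trans (x≤x+y y 0≤x) (≤-reflexive (+-comm _ _))

  0≤1 : 0# ≤ 1#
  0≤1 with total 0# 1#
  ... | inj₁ 0≤1 = 0≤1
  ... | inj₂ 1≤0 = begin
    0#          ≤⟨ *-nonNeg 0≤-1 0≤-1 ⟩
    - 1# * - 1# ≈⟨ -‿distribˡ-* 1# (- 1#) ⟨
    - (1# * - 1#) ≈⟨ -‿cong (*-identityˡ (- 1#)) ⟩
    - - 1#      ≈⟨ -‿involutive 1# ⟩
    1#          ∎
    where
    0≤-1 : 0# ≤ - 1#
    0≤-1 = ≤-trans (x+z≤y⇒x≤y-z (≤-trans (≤-reflexive (+-identityˡ 1#)) 1≤0))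
                   (≤-reflexive (+-identityˡ (- 1#)))

  *-monoˡ-≤ : ∀ {z} → 0# ≤ z → ∀ {x y} → x ≤ y → z * x ≤ z * y
  *-monoˡ-≤ {z} 0≤z {x} {y} x≤y = begin
    z * x               ≤⟨ y≤x+y (z * x) (*-nonNeg 0≤z 0≤y-x) ⟩
    z * (y - x) + z * x ≈⟨ distribˡ z (y - x) x ⟨
    z * ((y - x) + x)   ≈⟨ *-congˡ (x-y+y≈x y x) ⟩
    z * y               ∎
    where
    0≤y-x : 0# ≤ y - x
    0≤y-x = x+z≤y⇒x≤y-z (≤-trans (≤-reflexive (+-identityˡ x)) x≤y)

  *-monoʳ-≤ : ∀ {z} → 0# ≤ z → ∀ {x y} → x ≤ y → x * z ≤ y * z
  *-monoʳ-≤ {z} 0≤z {x} {y} x≤y = begin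
    x * z ≈⟨ *-comm x z ⟩
    z * x ≤⟨ *-monoˡ-≤ 0≤z x≤y ⟩
    z * y ≈⟨ *-comm z y ⟩
    y * z ∎

  *-mono-≤ : ∀ {u v x y} → 0# ≤ u → 0# ≤ x → u ≤ v → x ≤ y → u * x ≤ v * y
  *-mono-≤ 0≤u 0≤x u≤v x≤y =
    ≤-trans (*-monoʳ-≤ 0≤x u≤v) (*-monoˡ-≤ (≤-trans 0≤u u≤v) x≤y)

  x⁻¹*[x*y]≈y : ∀ {x} → ¬ (x ≈ 0#) → ∀ y → x ⁻¹ * (x * y) ≈ y
  x⁻¹*[x*y]≈y {x} x≉0 y = begin-equality
    x ⁻¹ * (x * y) ≈⟨ *-assoc (x ⁻¹) x y ⟨
    x ⁻¹ * x * y   ≈⟨ *-congʳ (trans (*-comm (x ⁻¹) x) (*-inverseʳ x≉0)) ⟩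
    1# * y         ≈⟨ *-identityˡ y ⟩
    y              ∎

  x*[x⁻¹*y]≈y : ∀ {x} → ¬ (x ≈ 0#) → ∀ y → x * (x ⁻¹ * y) ≈ y
  x*[x⁻¹*y]≈y {x} x≉0 y = begin-equality
    x * (x ⁻¹ * y) ≈⟨ *-assoc x (x ⁻¹) y ⟨
    x * x ⁻¹ * y   ≈⟨ *-congʳ (*-inverseʳ x≉0) ⟩
    1# * y         ≈⟨ *-identityˡ y ⟩
    y              ∎

  <⇒≉0 : ∀ {x} → 0# < x → ¬ (x ≈ 0#)
  <⇒≉0 (_ , 0≉x) x≈0 = 0≉x (sym x≈0)

  *-cancelˡ-≤ : ∀ {z x y} → 0# < z → z * x ≤ z * y → x ≤ y
  *-cancelˡ-≤ {z} {x} {y} 0<z@(0≤z , _) le with total x y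
  ... | inj₁ x≤y = x≤y
  ... | inj₂ y≤x = ≤-reflexive (begin-equality
    x              ≈⟨ x⁻¹*[x*y]≈y (<⇒≉0 0<z) x ⟨
    z ⁻¹ * (z * x) ≈⟨ *-congˡ (antisym le (*-monoˡ-≤ 0≤z y≤x)) ⟩
    z ⁻¹ * (z * y) ≈⟨ x⁻¹*[x*y]≈y (<⇒≉0 0<z) y ⟩
    y              ∎)

  x≤z*y⇒z⁻¹*x≤y : ∀ {x y z} → 0# < z → x ≤ z * y → z ⁻¹ * x ≤ y
  x≤z*y⇒z⁻¹*x≤y {x} 0<z le = *-cancelˡ-≤ 0<z (≤-trans (≤-reflexive (x*[x⁻¹*y]≈y (<⇒≉0 0<z) x)) le)

  z⁻¹*x≤y⇒x≤z*y : ∀ {x y z} → 0# < z → z ⁻¹ * x ≤ y → x ≤ z * y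
  z⁻¹*x≤y⇒x≤z*y {x} 0<z le =
    ≤-trans (≤-reflexive (sym (x*[x⁻¹*y]≈y (<⇒≉0 0<z) x))) (*-monoˡ-≤ (proj₁ 0<z) le)

  ι-+ : ∀ m n → ι (m ℕ.+ n) ≈ ι m + ι n
  ι-+ = ×-homo-+ 1#

  ι-* : ∀ m n → ι (m ℕ.* n) ≈ ι m * ι n
  ι-* = ×1-homo-*

  ι1≈1 : ι 1 ≈ 1#
  ι1≈1 = +-identityʳ 1#

  0≤ι : ∀ n → 0# ≤ ι n
  0≤ι zero    = ≤-refl
  0≤ι (suc n) = +-nonNeg 0≤1 (0≤ι n)

  ι-mono-≤ : ∀ {m n} → m ℕ.≤ n → ι m ≤ ι n
  ι-mono-≤ {n = n} ℕ.z≤n       = 0≤ι n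
  ι-mono-≤         (ℕ.s≤s m≤n) = +-monoʳ-≤ 1# (ι-mono-≤ m≤n)

  1≤ι : ∀ {n} → 1 ℕ.≤ n → 1# ≤ ι n
  1≤ι 1≤n = ≤-trans (≤-reflexive (sym ι1≈1)) (ι-mono-≤ 1≤n)

  1≤x⇒0<x : ∀ {x} → 1# ≤ x → 0# < x
  1≤x⇒0<x 1≤x = ≤-trans 0≤1 1≤x , λ 0≈x → 0≉1 (antisym 0≤1 (≤-trans 1≤x (≤-reflexive (sym 0≈x))))

  0<ι : ∀ {n} → 1 ℕ.≤ n → 0# < ι n
  0<ι 1≤n = 1≤x⇒0<x (1≤ι 1≤n)

  x+1≰x : ∀ {x} → ¬ (x + 1# ≤ x)
  x+1≰x {x} le = 0≉1 (antisym 0≤1 (+-cancelʳ-≤ x (begin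
    1# + x ≈⟨ +-comm 1# x ⟩
    x + 1# ≤⟨ le ⟩
    x      ≈⟨ +-identityˡ x ⟨
    0# + x ∎)))

  ι-cancel-≤ : ∀ m n → ι m ≤ ι n → m ℕ.≤ n
  ι-cancel-≤ m n le with m ℕ.≤? n
  ... | yes m≤n = m≤n
  ... | no  m≰n = contradiction
    (≤-trans (≤-reflexive (+-comm (ι n) 1#)) (≤-trans (ι-mono-≤ (ℕ.≰⇒> m≰n)) le)) x+1≰x

  ^-nonNeg : ∀ {x} → 0# ≤ x → ∀ n → 0# ≤ x ^ n
  ^-nonNeg 0≤x zero    = 0≤1
  ^-nonNeg 0≤x (suc n) = *-nonNeg 0≤x (^-nonNeg 0≤x n)

  ^-monoˡ-≤ : ∀ {x y} → 0# ≤ x → x ≤ y → ∀ n → x ^ n ≤ y ^ n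
  ^-monoˡ-≤ 0≤x x≤y zero    = ≤-refl
  ^-monoˡ-≤ 0≤x x≤y (suc n) = *-mono-≤ 0≤x (^-nonNeg 0≤x n) x≤y (^-monoˡ-≤ 0≤x x≤y n)

  ι-^ : ∀ m n → ι (m ℕ.^ n) ≈ ι m ^ n
  ι-^ m zero    = ι1≈1
  ι-^ m (suc n) = trans (ι-* m (m ℕ.^ n)) (*-congˡ (ι-^ m n))

  -- Otherwise the naturals have a least upper bound s, but then s - 1 is an upper bound too, since
  -- successors are also below s.
  archimedean : ∀ x → ∃ λ k → x ≤ ι k
  archimedean x with lem {∃ λ k → x ≤ ι k}
  ... | yes found = found
  ... | no  none  with complete (λ y → ∃ λ k → y ≈ ι k) (0# , 0 , refl) (x , bounded)
    where
    bounded : IsUpperBound (λ y → ∃ λ k → y ≈ ι k) x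
    bounded y (k , y≈ιk) with total y x
    ... | inj₁ y≤x = y≤x
    ... | inj₂ x≤y = contradiction (k , ≤-trans x≤y (≤-reflexive y≈ιk)) none
  ...   | s , ub , least = contradiction (x≤y-z⇒x+z≤y (least (s - 1#) λ y (k , y≈ιk) →
            x+z≤y⇒x≤y-z (≤-trans (≤-reflexive (trans (+-congʳ y≈ιk) (+-comm (ι k) 1#)))
                                 (ub (ι (suc k)) (suc k , refl))))) x+1≰x

  -- Replaces the passage to the limit T → ∞ in the competitive inequality.
  ι*-bounded : ∀ {e B} → (∀ T → ι T * e ≤ B) → e ≤ 0#
  ι*-bounded {e} {B} bound with lem {0# < e}
  ... | no  0≮e with total e 0#
  ...   | inj₁ e≤0 = e≤0
  ...   | inj₂ 0≤e with lem {0# ≈ e}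
  ...     | yes 0≈e = ≤-reflexive (sym 0≈e)
  ...     | no  0≉e = contradiction (0≤e , 0≉e) 0≮e
  ι*-bounded {e} {B} bound | yes 0<e with archimedean (e ⁻¹ * B)
  ... | k , le = +-cancelʳ-≤ (ι k * e) (begin
    e + ι k * e      ≈⟨ +-congʳ (*-identityˡ e) ⟨
    1# * e + ι k * e ≈⟨ distribʳ e 1# (ι k) ⟨
    ι (suc k) * e    ≤⟨ bound (suc k) ⟩
    B                ≤⟨ z⁻¹*x≤y⇒x≤z*y 0<e le ⟩
    e * ι k          ≈⟨ *-comm e (ι k) ⟩
    ι k * e          ≈⟨ +-identityˡ _ ⟨
    0# + ι k * e     ∎)

  x≤2^k : ∀ x → ∃ λ k → x ≤ ι 2 ^ k
  x≤2^k x with archimedean x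
  ... | k , x≤k = k , (begin
    x            ≤⟨ x≤k ⟩
    ι k          ≤⟨ ι-mono-≤ (ℕ.<⇒≤ (n<2^n k)) ⟩
    ι (2 ℕ.^ k)  ≈⟨ ι-^ 2 k ⟩
    ι 2 ^ k      ∎)
    where
    n<2^n : ∀ n → n ℕ.< 2 ℕ.^ n
    n<2^n zero    = ℕ.≤-refl
    n<2^n (suc n) = ℕ.+-mono-≤ (ℕ.m^n>0 2 n) (ℕ.≤-trans (n<2^n n) (ℕ.m≤m+n _ 0))

  2^-cancel-≤ : ∀ m n → ι 2 ^ m ≤ ι 2 ^ n → m ℕ.≤ n
  2^-cancel-≤ m n le with m ℕ.≤? n
  ... | yes m≤n = m≤n
  ... | no  m≰n = contradiction
    (ι-cancel-≤ _ _ (≤-trans (≤-reflexive (ι-^ 2 m)) (≤-trans le (≤-reflexive (sym (ι-^ 2 n))))))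
    (ℕ.<⇒≱ (ℕ.^-monoʳ-< 2 (ℕ.n<1+n 1) (ℕ.≰⇒> m≰n)))

  0≤2 : 0# ≤ ι 2
  0≤2 = 0≤ι 2

  minorant-≤ : ∀ p r q {z} → (ι p - ι r) * ι (suc q) ⁻¹ ≤ z → ι p ≤ ι r + ι (suc q) * z
  minorant-≤ p r q {z} le = begin
    ι p                    ≈⟨ x-y+y≈x (ι p) (ι r) ⟨
    (ι p - ι r) + ι r      ≤⟨ +-monoˡ-≤ (ι r) (z⁻¹*x≤y⇒x≤z*y (0<ι {suc q} (ℕ.s≤s ℕ.z≤n))
                                 (≤-trans (≤-reflexive (*-comm _ _)) le)) ⟩
    ι (suc q) * z + ι r    ≈⟨ +-comm _ _ ⟩
    ι r + ι (suc q) * z    ∎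

  ≤-minorant : ∀ p r q {z} → ι p ≤ ι r + ι (suc q) * z → (ι p - ι r) * ι (suc q) ⁻¹ ≤ z
  ≤-minorant p r q {z} le = ≤-trans (≤-reflexive (*-comm _ _))
    (x≤z*y⇒z⁻¹*x≤y (0<ι {suc q} (ℕ.s≤s ℕ.z≤n))
      (x≤y+z⇒x-z≤y (≤-trans le (≤-reflexive (+-comm _ _)))))

  -- The binary logarithm

  -- An upper bound of the minorants, with denominators cleared. Estimates of `log₂` go through
  -- `log₂-isBound` and `log₂-least` only, as inequalities between integer powers.
  IsLog₂Bound : ℝ → ℝ → Set
  IsLog₂Bound x z = ∀ p r q → ι 2 ^ p ≤ ι 2 ^ r * x ^ suc q → ι p ≤ ι r + ι (suc q) * z

  log₂-bounded : ∀ {x} → 0# ≤ x → ∃ (IsLog₂Bound x)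
  log₂-bounded {x} 0≤x with x≤2^k x
  ... | k , x≤2^k = ι k , λ p r q le → begin
    ι p                        ≤⟨ ι-mono-≤ (2^-cancel-≤ p (r ℕ.+ k ℕ.* suc q) (begin
        ι 2 ^ p                        ≤⟨ le ⟩
        ι 2 ^ r * x ^ suc q            ≤⟨ *-monoˡ-≤ (^-nonNeg 0≤2 r) (^-monoˡ-≤ 0≤x x≤2^k (suc q)) ⟩
        ι 2 ^ r * (ι 2 ^ k) ^ suc q    ≈⟨ *-congˡ (^-assocʳ (ι 2) k (suc q)) ⟩
        ι 2 ^ r * ι 2 ^ (k ℕ.* suc q)  ≈⟨ ^-homo-* (ι 2) r (k ℕ.* suc q) ⟨
        ι 2 ^ (r ℕ.+ k ℕ.* suc q)      ∎)) ⟩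
    ι (r ℕ.+ k ℕ.* suc q)      ≈⟨ ι-+ r (k ℕ.* suc q) ⟩
    ι r + ι (k ℕ.* suc q)      ≈⟨ +-congˡ (trans (ι-* k (suc q)) (*-comm _ _)) ⟩
    ι r + ι (suc q) * ι k      ∎

  -- Rules out the default value of `log₂`: for x ≥ 1 the number 0 is a minorant (p = r = q = 0),
  -- and a power of two above x bounds all minorants.
  log₂-isLeastUpperBound : ∀ {x} → 1# ≤ x → IsLeastUpperBound (log₂Minorant x) (log₂ x)
  log₂-isLeastUpperBound {x} 1≤x with lem {∃ (log₂Minorant x) × BoundedAbove (log₂Minorant x)}
  ... | yes (ne , bdd) = proj₂ (complete (log₂Minorant x) ne bdd)
  ... | no  ¬sup = contradiction ((_ , 0 , 0 , 0 , refl , nonempty) , bounded) ¬sup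
    where
    nonempty : 1# ≤ 1# * (x * 1#)
    nonempty = ≤-trans 1≤x (≤-reflexive (sym (trans (*-identityˡ _) (*-identityʳ x))))
    bounded : BoundedAbove (log₂Minorant x)
    bounded with log₂-bounded (≤-trans 0≤1 1≤x)
    ... | z , z-bound = z , λ { y (p , r , q , y≈ , le) →
      ≤-trans (≤-reflexive y≈) (≤-minorant p r q (z-bound p r q le)) }

  log₂-isBound : ∀ {x} → 1# ≤ x → IsLog₂Bound x (log₂ x)
  log₂-isBound 1≤x p r q le =
    minorant-≤ p r q (proj₁ (log₂-isLeastUpperBound 1≤x) _ (p , r , q , refl , le))

  log₂-least : ∀ {x} → 1# ≤ x → ∀ {z} → IsLog₂Bound x z → log₂ x ≤ z
  log₂-least 1≤x z-bound = proj₂ (log₂-isLeastUpperBound 1≤x) _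
    λ { y (p , r , q , y≈ , le) → ≤-trans (≤-reflexive y≈) (≤-minorant p r q (z-bound p r q le)) }

-- Finite sums, series and infima with values in the extended reals

module ExtendedReals (lem : ExcludedMiddle 0ℓ) (R : CompleteOrderedField) where
  open MTS lem R
  open OrderedField lem R
  open ≤-Reasoning
  open CommutativeRing commutativeRing using (zeroˡ; zeroʳ)
  open import Algebra.Properties.CommutativeMonoid.Sum +-commutativeMonoid using (sum; ∑-distrib-+)

  sum-mono-≤ : ∀ {k} {f g : Fin k → ℝ} → (∀ i → f i ≤ g i) → sum f ≤ sum g
  sum-mono-≤ {zero}  f≤g = ≤-refl
  sum-mono-≤ {suc k} f≤g = +-mono-≤ (f≤g zero) (sum-mono-≤ (f≤g ∘ suc))

  sum-const : ∀ k x → sum {k} (λ _ → x) ≈ ι k * x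
  sum-const zero    x = sym (zeroˡ x)
  sum-const (suc k) x = begin-equality
    x + sum {k} (λ _ → x) ≈⟨ +-cong (sym (*-identityˡ x)) (sum-const k x) ⟩
    1# * x + ι k * x      ≈⟨ distribʳ x 1# (ι k) ⟨
    (1# + ι k) * x        ∎

  sum-single-≤ : ∀ {k} {f : Fin k → ℝ} {e} j → f j ≤ e → (∀ i → i ≢ j → f i ≤ 0#) → sum f ≤ e
  sum-single-≤ {suc k} {f} {e} zero    fj≤e rest = begin
    f zero + sum (f ∘ suc)         ≤⟨ +-mono-≤ fj≤e (sum-mono-≤ (λ i → rest (suc i) λ ())) ⟩
    e + sum {k} (λ _ → 0#)         ≈⟨ +-congˡ (trans (sum-const k 0#) (zeroʳ (ι k))) ⟩
    e + 0#                         ≈⟨ +-identityʳ e ⟩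
    e                              ∎
  sum-single-≤ {suc k} {f} {e} (suc j) fj≤e rest = begin
    f zero + sum (f ∘ suc) ≤⟨ +-mono-≤ (rest zero λ ())
                                (sum-single-≤ j fj≤e (λ i i≢j → rest (suc i) λ { ≡.refl → i≢j ≡.refl })) ⟩
    0# + e                 ≈⟨ +-identityˡ e ⟩
    e                      ∎

  partialSum-mono : ∀ {f} → (∀ t → 0# ≤ f t) → ∀ {S T} → S ℕ.≤ T → partialSum f S ≤ partialSum f T
  partialSum-mono {f} 0≤f {S} {T} S≤T = ≡.subst (λ i → partialSum f S ≤ partialSum f i) (ℕ.m∸n+n≡m S≤T) (go (T ℕ.∸ S))
    where
    go : ∀ k → partialSum f S ≤ partialSum f (k ℕ.+ S)
    go zero    = ≤-refl
    go (suc k) = ≤-trans (go k) (x≤x+y _ (0≤f _))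

  partialSum-eventually : ∀ {f} → (∀ t → 0# ≤ f t) → ∀ T → (∀ t → T ℕ.≤ t → f t ≤ 0#) →
                          ∀ S → partialSum f S ≤ partialSum f T
  partialSum-eventually {f} 0≤f T f≤0 S with ℕ.≤-total S T
  ... | inj₁ S≤T = partialSum-mono 0≤f S≤T
  ... | inj₂ T≤S = ≡.subst (λ i → partialSum f i ≤ partialSum f T) (ℕ.m∸n+n≡m T≤S) (go (S ℕ.∸ T))
    where
    go : ∀ k → partialSum f (k ℕ.+ T) ≤ partialSum f T
    go zero    = ≤-refl
    go (suc k) = ≤-trans (+-mono-≤ (go k) (f≤0 _ (ℕ.m≤n+m T k))) (≤-reflexive (+-identityʳ _))

  partialSum-sum : ∀ {k} (f : Fin k → ℕ → ℝ) T →
                   sum (λ i → partialSum (f i) (suc T)) ≈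
                   sum (λ i → partialSum (f i) T) + sum (λ i → f i T)
  partialSum-sum f T = ∑-distrib-+ (λ i → partialSum (f i) T) (λ i → f i T)

  ≤⁺-refl : ∀ {x} → x ≤⁺ x
  ≤⁺-refl {[ x ]} = [ ≤-refl ]
  ≤⁺-refl {⊤⁺}    = ⊤⁺ ≤⊤⁺

  ≤⁺-trans : ∀ {x y z} → x ≤⁺ y → y ≤⁺ z → x ≤⁺ z
  ≤⁺-trans = AddSupremum.≤⁺-trans _≤_ ≤-trans

  ≤⁺[]⇒finite : ∀ {x B} → x ≤⁺ [ B ] → ∃ λ y → x ≡ [ y ] × y ≤ B
  ≤⁺[]⇒finite [ y≤B ] = _ , ≡.refl , y≤B

  x≤⁺x+⁺y : ∀ x {y} → [ 0# ] ≤⁺ y → x ≤⁺ x +⁺ y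
  x≤⁺x+⁺y [ x ] [ 0≤y ]   = [ x≤x+y x 0≤y ]
  x≤⁺x+⁺y [ x ] (_ ≤⊤⁺)   = _ ≤⊤⁺
  x≤⁺x+⁺y ⊤⁺    _         = ≤⁺-refl

  y≤⁺x+⁺y : ∀ {x} y → [ 0# ] ≤⁺ x → y ≤⁺ x +⁺ y
  y≤⁺x+⁺y [ y ] [ 0≤x ]   = [ y≤x+y y 0≤x ]
  y≤⁺x+⁺y ⊤⁺    [ 0≤x ]   = ≤⁺-refl
  y≤⁺x+⁺y y     (_ ≤⊤⁺)   = _ ≤⊤⁺

  sum⁺ : ∀ {k} → (Fin k → ℝ⁺) → ℝ⁺
  sum⁺ = foldr _+⁺_ [ 0# ]

  sum⁺-nonNeg : ∀ {k} (f : Fin k → ℝ⁺) → (∀ i → [ 0# ] ≤⁺ f i) → [ 0# ] ≤⁺ sum⁺ f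
  sum⁺-nonNeg {zero}  f 0≤f = ≤⁺-refl
  sum⁺-nonNeg {suc k} f 0≤f =
    ≤⁺-trans (0≤f zero) (x≤⁺x+⁺y (f zero) (sum⁺-nonNeg (f ∘ suc) (0≤f ∘ suc)))

  term≤⁺sum⁺ : ∀ {k} (f : Fin k → ℝ⁺) → (∀ i → [ 0# ] ≤⁺ f i) → ∀ i → f i ≤⁺ sum⁺ f
  term≤⁺sum⁺ f 0≤f zero    = x≤⁺x+⁺y (f zero) (sum⁺-nonNeg (f ∘ suc) (0≤f ∘ suc))
  term≤⁺sum⁺ f 0≤f (suc i) =
    ≤⁺-trans (term≤⁺sum⁺ (f ∘ suc) (0≤f ∘ suc) i) (y≤⁺x+⁺y _ (0≤f zero))

  sup-least : ∀ {P ne B} → IsUpperBound P B → sup P ne ≤⁺ [ B ]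
  sup-least {P} {ne} {B} ub with lem {BoundedAbove P}
  ... | yes bdd = [ proj₂ (proj₂ (complete P ne bdd)) B ub ]
  ... | no  ¬bdd = contradiction (B , ub) ¬bdd

  sup-upper : ∀ {P ne x} → P x → [ x ] ≤⁺ sup P ne
  sup-upper {P} {ne} {x} Px with lem {BoundedAbove P}
  ... | yes bdd = [ proj₁ (proj₂ (complete P ne bdd)) x Px ]
  ... | no  _   = _ ≤⊤⁺

  series-least : ∀ {f B} → (∀ T → partialSum f T ≤ B) → series f ≤⁺ [ B ]
  series-least bound = sup-least λ { x (T , x≈) → ≤-trans (≤-reflexive x≈) (bound T) }

  partialSum≤⁺series : ∀ f T → [ partialSum f T ] ≤⁺ series f
  partialSum≤⁺series f T = sup-upper (T , refl)

  inf-lower : ∀ {I : Set} {f : I → ℝ⁺} {bdd} i → inf f bdd ≤⁺ f i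
  inf-lower {f = f} i with f i in eq
  ... | ⊤⁺    = _ ≤⊤⁺
  ... | [ B ] = sup-least λ y y≤f → AddSupremum.[≤]-injective _≤_ (≡.subst ([ y ] ≤⁺_) eq (y≤f i))

  inf-greatest : ∀ {I : Set} {f : I → ℝ⁺} {bdd y} → IsLowerBound f y → [ y ] ≤⁺ inf f bdd
  inf-greatest y≤f = sup-upper y≤f

  -- The suprema are taken one at a time. With the horizon `S` of the first series fixed, the others
  -- together stay below `B` minus its partial sum, because both horizons can be raised to their
  -- maximum; then `S` varies.
  sum⁺-series-≤ : ∀ {k} (f : Fin k → ℕ → ℝ) → (∀ i t → 0# ≤ f i t) → ∀ {B} →
                  (∀ T → sum (λ i → partialSum (f i) T) ≤ B) → sum⁺ (λ i → series (f i)) ≤⁺ [ B ]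
  sum⁺-series-≤ {zero}  f 0≤f bound = [ bound 0 ]
  sum⁺-series-≤ {suc k} f 0≤f {B} bound
    with series (f zero) in eq | sum⁺ (λ i → series (f (suc i))) in eq′ | tails
    where
    tails : ∀ S → sum⁺ (λ i → series (f (suc i))) ≤⁺ [ B - partialSum (f zero) S ]
    tails S = sum⁺-series-≤ (f ∘ suc) (0≤f ∘ suc) λ T → x+z≤y⇒x≤y-z (begin
      sum (λ i → partialSum (f (suc i)) T) + partialSum (f zero) S
        ≤⟨ +-mono-≤ (sum-mono-≤ λ i → partialSum-mono (0≤f (suc i)) (ℕ.m≤m⊔n T S))
                    (partialSum-mono (0≤f zero) (ℕ.m≤n⊔m T S)) ⟩
      sum (λ i → partialSum (f (suc i)) (T ℕ.⊔ S)) + partialSum (f zero) (T ℕ.⊔ S)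
        ≈⟨ +-comm _ _ ⟩
      sum (λ i → partialSum (f i) (T ℕ.⊔ S))
        ≤⟨ bound (T ℕ.⊔ S) ⟩
      B ∎)
  -- The bound for S = 0 already makes the remaining series finite.
  ... | x | ⊤⁺    | tails with tails 0
  ...   | ()
  sum⁺-series-≤ {suc k} f 0≤f {B} bound | x | [ y ] | tails
    with ≤⁺[]⇒finite (≡.subst (_≤⁺ [ B - y ]) eq (series-least {f zero} {B - y} λ S →
      x+z≤y⇒x≤y-z (≤-trans (≤-reflexive (+-comm _ _))
        (x≤y-z⇒x+z≤y (AddSupremum.[≤]-injective _≤_ (tails S))))))
  ... | x′ , ≡.refl , x′≤ = [ x≤y-z⇒x+z≤y x′≤ ]

-- Part (i): logarithmic estimates

module LowerBound (lem : ExcludedMiddle 0ℓ) (R : CompleteOrderedField) where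
  open MTS lem R
  open OrderedField lem R
  open ExtendedReals lem R
  open ≤-Reasoning
  open CommutativeRing commutativeRing using (zeroˡ; zeroʳ)
  open import Algebra.Properties.CommutativeMonoid.Sum +-commutativeMonoid using (sum; sum-cong-≋)
  open import Algebra.Properties.Semiring.Exp semiring using (^-congˡ; ^-homo-*; ^-assocʳ)
  open import Algebra.Properties.CommutativeSemiring.Exp commutativeSemiring using (^-distrib-*)
  open import Algebra.Solver.Ring.NaturalCoefficients.Default commutativeSemiring
    using (solve; _:+_; _:*_; _:=_; con)

  3≤2*log₂ : ∀ {n} → 3 ℕ.≤ n → ι 3 ≤ ι 2 * log₂ (ι n)
  3≤2*log₂ {n} 3≤n = ≤-trans (log₂-isBound (1≤ι (ℕ.≤-trans (ℕ.s≤s ℕ.z≤n) 3≤n)) 3 0 1 (begin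
    ι 2 ^ 3          ≈⟨ ι-^ 2 3 ⟨
    ι 8              ≤⟨ ι-mono-≤ (ℕ.n≤1+n 8) ⟩
    ι (3 ℕ.^ 2)      ≈⟨ ι-^ 3 2 ⟩
    ι 3 ^ 2          ≤⟨ ^-monoˡ-≤ (0≤ι 3) (ι-mono-≤ 3≤n) 2 ⟩
    ι n ^ 2          ≈⟨ *-identityˡ _ ⟨
    1# * ι n ^ 2     ∎)) (≤-reflexive (+-identityˡ _))

  1≤log₂ : ∀ {n} → 3 ℕ.≤ n → 1# ≤ log₂ (ι n)
  1≤log₂ {n} 3≤n = *-cancelˡ-≤ (0<ι {2} (ℕ.s≤s ℕ.z≤n)) (begin
    ι 2 * 1#         ≈⟨ *-identityʳ (ι 2) ⟩
    ι 2              ≤⟨ ι-mono-≤ (ℕ.n≤1+n 2) ⟩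
    ι 3              ≤⟨ 3≤2*log₂ 3≤n ⟩
    ι 2 * log₂ (ι n) ∎)

  -- log₂ 3 ≥ 3/2 > √2.
  1≤2*log₂log₂ : ∀ {n} → 3 ℕ.≤ n → 1# ≤ ι 2 * log₂ (log₂ (ι n))
  1≤2*log₂log₂ {n} 3≤n = begin
    1#                            ≈⟨ ι1≈1 ⟨
    ι 1                           ≤⟨ log₂-isBound (1≤log₂ 3≤n) 1 0 1 2≤L² ⟩
    0# + ι 2 * log₂ L             ≈⟨ +-identityˡ _ ⟩
    ι 2 * log₂ L                  ∎
    where
    L = log₂ (ι n)
    2≤L² : ι 2 ^ 1 ≤ 1# * L ^ 2
    2≤L² = *-cancelˡ-≤ (0<ι {4} (ℕ.s≤s ℕ.z≤n)) (begin
      ι 4 * (ι 2 * 1#)            ≈⟨ *-congˡ (*-identityʳ (ι 2)) ⟩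
      ι 4 * ι 2                   ≈⟨ ι-* 4 2 ⟨
      ι 8                         ≤⟨ ι-mono-≤ (ℕ.n≤1+n 8) ⟩
      ι (3 ℕ.* 3)                 ≈⟨ ι-* 3 3 ⟩
      ι 3 * ι 3                   ≤⟨ *-mono-≤ (0≤ι 3) (0≤ι 3) (3≤2*log₂ 3≤n) (3≤2*log₂ 3≤n) ⟩
      (ι 2 * L) * (ι 2 * L)       ≈⟨ solve 2 (λ t l → t :* l :* (t :* l) := t :* t :* (con 1 :* (l :* (l :* con 1))))
                                       refl (ι 2) L ⟩
      (ι 2 * ι 2) * (1# * L ^ 2)  ≈⟨ *-congʳ (ι-* 2 2) ⟨
      ι 4 * (1# * L ^ 2)          ∎)

  -- Taking logarithms gives b + K + 2 log log n. As log log n ≥ 1/2, the constant K is at most 2K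
  -- log log n.
  log₂-bound : ∀ {n b K} → 3 ℕ.≤ n → ι n ≤ ι 2 ^ b * (ι 2 ^ K * log₂ (ι n) ^ 2) →
               log₂ (ι n) ≤ ι b + ι (2 ℕ.+ 2 ℕ.* K) * log₂ (log₂ (ι n))
  log₂-bound {n} {b} {K} 3≤n n≤ =
    log₂-least (1≤ι (ℕ.≤-trans (ℕ.s≤s ℕ.z≤n) 3≤n)) λ p r q le → begin
      ι p
        -- Applied to log n in place of n; `q + suc (q + 0)` is the predecessor of `2 * suc q`, the
        -- exponent of log n.
        ≤⟨ log₂-isBound (1≤log₂ 3≤n) p (r ℕ.+ (b ℕ.+ K) ℕ.* suc q) (q ℕ.+ suc (q ℕ.+ 0)) (begin
          ι 2 ^ p
            ≤⟨ le ⟩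
          ι 2 ^ r * ι n ^ suc q
            ≤⟨ *-monoˡ-≤ (^-nonNeg 0≤2 r) (^-monoˡ-≤ (0≤ι n) n≤ (suc q)) ⟩
          ι 2 ^ r * (ι 2 ^ b * (ι 2 ^ K * L ^ 2)) ^ suc q
            ≈⟨ *-congˡ (^-congˡ (suc q) (trans (sym (*-assoc _ _ _)) (*-congʳ (sym (^-homo-* (ι 2) b K))))) ⟩
          ι 2 ^ r * (ι 2 ^ (b ℕ.+ K) * L ^ 2) ^ suc q
            ≈⟨ *-congˡ (^-distrib-* (ι 2 ^ (b ℕ.+ K)) (L ^ 2) (suc q)) ⟩
          ι 2 ^ r * ((ι 2 ^ (b ℕ.+ K)) ^ suc q * (L ^ 2) ^ suc q)
            ≈⟨ *-congˡ (*-cong (^-assocʳ (ι 2) (b ℕ.+ K) (suc q)) (^-assocʳ L 2 (suc q))) ⟩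
          ι 2 ^ r * (ι 2 ^ ((b ℕ.+ K) ℕ.* suc q) * L ^ (2 ℕ.* suc q))
            ≈⟨ *-assoc _ _ _ ⟨
          ι 2 ^ r * ι 2 ^ ((b ℕ.+ K) ℕ.* suc q) * L ^ (2 ℕ.* suc q)
            ≈⟨ *-congʳ (^-homo-* (ι 2) r ((b ℕ.+ K) ℕ.* suc q)) ⟨
          ι 2 ^ (r ℕ.+ (b ℕ.+ K) ℕ.* suc q) * L ^ (2 ℕ.* suc q) ∎) ⟩
      ι (r ℕ.+ (b ℕ.+ K) ℕ.* suc q) + ι (2 ℕ.* suc q) * ℓ
        ≈⟨ +-cong (trans (ι-+ r _) (+-congˡ (trans (ι-* (b ℕ.+ K) (suc q)) (*-congʳ (ι-+ b K)))))
                  (*-congʳ (ι-* 2 (suc q))) ⟩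
      (ι r + (ι b + ι K) * ι (suc q)) + ι 2 * ι (suc q) * ℓ
        ≈⟨ solve 6 (λ r b K q t ℓ → (r :+ (b :+ K) :* q) :+ t :* q :* ℓ
                                 := (r :+ q :* (b :+ t :* ℓ)) :+ q :* (K :* con 1))
             refl (ι r) (ι b) (ι K) (ι (suc q)) (ι 2) ℓ ⟩
      (ι r + ι (suc q) * (ι b + ι 2 * ℓ)) + ι (suc q) * (ι K * 1#)
        ≤⟨ +-monoʳ-≤ _ (*-monoˡ-≤ (0≤ι (suc q)) (*-monoˡ-≤ (0≤ι K) (1≤2*log₂log₂ 3≤n))) ⟩
      (ι r + ι (suc q) * (ι b + ι 2 * ℓ)) + ι (suc q) * (ι K * (ι 2 * ℓ))
        ≈⟨ solve 6 (λ r b K q t ℓ → (r :+ q :* (b :+ t :* ℓ)) :+ q :* (K :* (t :* ℓ))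
                                 := r :+ q :* (b :+ (t :+ t :* K) :* ℓ))
             refl (ι r) (ι b) (ι K) (ι (suc q)) (ι 2) ℓ ⟩
      ι r + ι (suc q) * (ι b + (ι 2 + ι 2 * ι K) * ℓ)
        ≈⟨ +-congˡ (*-congˡ (+-congˡ (*-congʳ (trans (ι-+ 2 (2 ℕ.* K)) (+-congˡ (ι-* 2 K)))))) ⟨
      ι r + ι (suc q) * (ι b + ι (2 ℕ.+ 2 ℕ.* K) * ℓ) ∎
    where
    L = log₂ (ι n)
    ℓ = log₂ L

  -- Zeros are skipped because a row of distances contains its diagonal entry. The value 1 of the
  -- empty family caps the result, which only has to be a positive lower bound.
  positive-min : ∀ {k} (f : Fin k → ℝ) → ∃ λ e → 0# < e × ∀ i → 0# < f i → e ≤ f i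
  positive-min {zero}  f = 1# , 1≤x⇒0<x ≤-refl , λ ()
  positive-min {suc k} f with positive-min (f ∘ suc) | lem {0# < f zero}
  ... | e , 0<e , e≤ | no  0≮f0 = e , 0<e , λ { zero 0<f0 → contradiction 0<f0 0≮f0 ; (suc i) → e≤ i }
  ... | e , 0<e , e≤ | yes 0<f0 with total e (f zero)
  ...   | inj₁ e≤f0 = e , 0<e , λ { zero _ → e≤f0 ; (suc i) → e≤ i }
  ...   | inj₂ f0≤e = f zero , 0<f0 , λ { zero _ → ≤-refl ; (suc i) 0<fi → ≤-trans f0≤e (e≤ i 0<fi) }

  -- The adversary against one seed

  module _ {n : ℕ} (M : FiniteMetricSpace n) where

    open FiniteMetricSpace M
    open IsGeneralMetric isMetric using (nonNegative; ≈⇒0; 0⇒≈)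
    open Inverse enumeration using (to; from; strictlyInverseˡ; strictlyInverseʳ)

    min-distance : ∃ λ e → 0# < e × ∀ x y → x ≢ y → e ≤ d x y
    min-distance with positive-min (λ i → proj₁ (positive-min (λ j → d (to i) (to j))))
    ... | e , 0<e , e≤ = e , 0<e , λ x y x≢y →
      ≡.subst₂ (λ u v → e ≤ d u v) (strictlyInverseˡ x) (strictlyInverseˡ y)
        (≤-trans (e≤ (from x) (proj₁ (proj₂ (near (from x)))))
          (proj₂ (proj₂ (near (from x))) (from y)
            (nonNegative , λ 0≈d → x≢y (≡.trans (≡.sym (strictlyInverseˡ x))
              (≡.trans (0⇒≈ (sym 0≈d)) (strictlyInverseˡ y))))))
      where
      near : ∀ i → ∃ λ e → 0# < e × ∀ j → 0# < d (to i) (to j) → e ≤ d (to i) (to j)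
      near i = positive-min (λ j → d (to i) (to j))

    stepCost : (ℕ → Point) → CostSequence M → ℕ → ℝ
    stepCost ρ c t = d (ρ t) (ρ (suc t)) + proj₁ (c t (ρ (suc t)))

    stepCost-nonNeg : ∀ ρ c t → 0# ≤ stepCost ρ c t
    stepCost-nonNeg ρ c t = +-nonNeg nonNegative (proj₂ (c t (ρ (suc t))))

    module _ {e : ℝ} (0<e : 0# < e) (e≤d : ∀ x y → x ≢ y → e ≤ d x y) where

      hit : Point → CostVector M
      hit x y with lem {y ≡ x}
      ... | yes _ = e , proj₁ 0<e
      ... | no  _ = 0# , ≤-refl

      hit-self : ∀ x → proj₁ (hit x x) ≈ e
      hit-self x with lem {x ≡ x}
      ... | yes _   = refl
      ... | no  x≢x = contradiction ≡.refl x≢x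

      hit-other : ∀ {x y} → y ≢ x → proj₁ (hit x y) ≈ 0#
      hit-other {x} {y} y≢x with lem {y ≡ x}
      ... | yes y≡x = contradiction y≡x y≢x
      ... | no  _   = refl

      sum-hit : ∀ x → sum (λ i → proj₁ (hit x (to i))) ≤ e
      sum-hit x = sum-single-≤ (from x)
        (≤-reflexive (trans (reflexive (≡.cong (proj₁ ∘ hit x) (strictlyInverseˡ x))) (hit-self x)))
        (λ i i≢ → ≤-reflexive (hit-other λ toi≡x →
          i≢ (≡.trans (≡.sym (strictlyInverseʳ i)) (≡.cong from toi≡x))))

      e≤move+hit : ∀ x y → e ≤ d x y + proj₁ (hit x y)
      e≤move+hit x y with lem {y ≡ x}
      ... | yes _   = y≤x+y e nonNegative
      ... | no  y≢x = ≤-trans (e≤d x y (y≢x ∘ ≡.sym)) (≤-reflexive (sym (+-identityʳ _)))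

      module Adversary {Seed : Set} (A : Algorithm M Seed) (s : Seed) (T : ℕ) where

        open Algorithm A

        -- Silence from time `T` on bounds the cost of a static schedule, hence `OPT`, by what
        -- happens before `T`.
        request : ℕ → List (CostVector M) → CostVector M
        request t cs with t ℕ.<? T
        ... | yes _ = hit (state cs s)
        ... | no  _ = λ _ → 0# , ≤-refl

        -- Requests depend on the state and the state on earlier requests; recursion on the list of
        -- requests unties this. `applyUpTo-requests` shows that it is the list the algorithm sees.
        history : ℕ → List (CostVector M)
        history zero    = []
        history (suc t) = history t ∷ʳ request t (history t)

        requests : CostSequence M
        requests t = request t (history t)

        applyUpTo-requests : ∀ t → applyUpTo requests t ≡ history t
        applyUpTo-requests zero    = ≡.refl
        applyUpTo-requests (suc t) = ≡.trans (≡.sym (applyUpTo-∷ʳ requests t))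
          (≡.cong (_∷ʳ requests t) (applyUpTo-requests t))

        requests-< : ∀ {t} → t ℕ.< T → requests t ≡ hit (output requests s t)
        requests-< {t} t<T with t ℕ.<? T
        ... | yes _   = ≡.cong (λ cs → hit (state cs s)) (≡.sym (applyUpTo-requests t))
        ... | no  t≮T = contradiction t<T t≮T

        requests-≥ : ∀ {t} x → T ℕ.≤ t → proj₁ (requests t x) ≈ 0#
        requests-≥ {t} x T≤t with t ℕ.<? T
        ... | yes t<T = contradiction T≤t (ℕ.<⇒≱ t<T)
        ... | no  _   = refl

        algorithm-cost : ∀ S → S ℕ.≤ T → ι S * e ≤ partialSum (stepCost (output requests s) requests) S
        algorithm-cost zero    _   = ≤-reflexive (zeroˡ e)
        algorithm-cost (suc S) S<T = begin
          (1# + ι S) * e           ≈⟨ solve 2 (λ k e → (con 1 :+ k) :* e := k :* e :+ e) refl (ι S) e ⟩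
          ι S * e + e              ≤⟨ +-mono-≤ (algorithm-cost S (ℕ.<⇒≤ S<T)) (e≤move+hit _ _) ⟩
          P + (d x y + proj₁ (hit x y))        ≡⟨ ≡.cong (λ c → P + (d x y + proj₁ (c y))) (requests-< S<T) ⟨
          P + (d x y + proj₁ (requests S y))   ∎
          where
          P = partialSum (stepCost (output requests s) requests) S
          x = output requests s S
          y = output requests s (suc S)

        static : Fin n → ℕ → ℝ
        static i = stepCost (λ _ → to i) requests

        static≈ : ∀ i t → static i t ≈ proj₁ (requests t (to i))
        static≈ i t = trans (+-congʳ (≈⇒0 ≡.refl)) (+-identityˡ _)

        static-cost : ∀ S → S ℕ.≤ T → sum (λ i → partialSum (static i) S) ≤ ι S * e
        static-cost zero    _   = ≤-reflexive (trans (sum-const n 0#)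
          (trans (zeroʳ (ι n)) (sym (zeroˡ e))))
        static-cost (suc S) S<T = begin
          sum (λ i → partialSum (static i) (suc S))
            ≈⟨ partialSum-sum static S ⟩
          sum (λ i → partialSum (static i) S) + sum (λ i → static i S)
            ≤⟨ +-mono-≤ (static-cost S (ℕ.<⇒≤ S<T)) (begin
              sum (λ i → static i S)                              ≈⟨ sum-cong-≋ (λ i → static≈ i S) ⟩
              sum (λ i → proj₁ (requests S (to i)))               ≡⟨ ≡.cong (λ c → sum (λ i → proj₁ (c (to i)))) (requests-< S<T) ⟩
              sum (λ i → proj₁ (hit (output requests s S) (to i))) ≤⟨ sum-hit _ ⟩
              e                                                   ∎) ⟩
          ι S * e + e
            ≈⟨ solve 2 (λ k e → (con 1 :+ k) :* e := k :* e :+ e) refl (ι S) e ⟨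
          (1# + ι S) * e ∎

        OPT≤static : ∀ i → OPT M requests ≤⁺ [ partialSum (static i) T ]
        OPT≤static i = ≤⁺-trans (inf-lower (λ _ → to i)) (series-least
          (partialSum-eventually (stepCost-nonNeg (λ _ → to i) requests) T
            (λ t T≤t → ≤-reflexive (trans (static≈ i t) (requests-≥ (to i) T≤t)))))

      module _ {b α} (0≤α : 0# ≤ α) (A : BitAlgorithm M b) (comp : IsCompetitive M b α A) where

        open Algorithm A

        private
          m = 2 ℕ.^ b
          β = proj₁ comp
          s = fromℕ< (ℕ.m^n>0 2 b)

        -- A single seed has weight 1/2^b and the other seeds contribute nonnegative costs; this is
        -- the only loss due to randomness.
        𝔼-≤ : ∀ f {x B} → (∀ i → [ 0# ] ≤⁺ f i) → [ x ] ≤⁺ f s → 𝔼 b f ≤⁺ [ B ] → x ≤ ι m * B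
        𝔼-≤ f 0≤f x≤fs 𝔼≤B with sum⁺ f | ≤⁺-trans x≤fs (term≤⁺sum⁺ f 0≤f s)
        𝔼-≤ f 0≤f x≤fs [ 𝔼≤B ] | [ y ] | [ x≤y ] = ≤-trans x≤y (z⁻¹*x≤y⇒x≤z*y (0<ι (ℕ.m^n>0 2 b)) 𝔼≤B)

        -- Averaging over the static schedules: n times `OPT` is at most their total cost, at most T
        -- e, whereas the fixed seed alone pays at least T e.
        cost-bound : 1 ℕ.≤ n → ∀ T → ι n * (ι T * e) ≤ ι m * α * (ι T * e) + ι n * (ι m * β)
        cost-bound 1≤n T with OPT M requests in eq | ≤⁺[]⇒finite (OPT≤static (fromℕ< 1≤n))
          where open Adversary A s T
        ... | _ | o , ≡.refl , _ = begin
          ι n * (ι T * e)                       ≤⟨ *-monoˡ-≤ (0≤ι n) (≤-trans (algorithm-cost T ℕ.≤-refl)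
                                                    (𝔼-≤ _ (λ i → series-nonNeg _ ) (partialSum≤⁺series _ T)
                                                      (≡.subst (λ z → 𝔼 b (λ s → Cost M (output requests s) requests) ≤⁺ α *⁺ z +⁺ [ β ]) eq
                                                        (proj₂ comp requests)))) ⟩
          ι n * (ι m * (α * o + β))             ≈⟨ solve 5 (λ n m a o b → n :* (m :* (a :* o :+ b)) := m :* a :* (n :* o) :+ n :* (m :* b))
                                                     refl (ι n) (ι m) α o β ⟩
          ι m * α * (ι n * o) + ι n * (ι m * β) ≤⟨ +-monoˡ-≤ _ (*-monoˡ-≤ (*-nonNeg (0≤ι m) 0≤α) (begin
            ι n * o                               ≈⟨ sum-const n o ⟨
            sum {n} (λ _ → o)                     ≤⟨ sum-mono-≤ (λ i → AddSupremum.[≤]-injective _≤_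
                                                       (≡.subst (_≤⁺ [ partialSum (static i) T ]) eq (OPT≤static i))) ⟩
            sum (λ i → partialSum (static i) T)   ≤⟨ static-cost T ℕ.≤-refl ⟩
            ι T * e                               ∎)) ⟩
          ι m * α * (ι T * e) + ι n * (ι m * β) ∎
          where open Adversary A s T

        n≤2^b*α : 1 ℕ.≤ n → ι n ≤ ι m * α
        n≤2^b*α 1≤n = *-cancelˡ-≤ 0<e (begin
          e * ι n                   ≈⟨ x-y+y≈x (e * ι n) (e * (ι m * α)) ⟨
          Δ + e * (ι m * α)         ≤⟨ +-monoˡ-≤ _ (ι*-bounded Δ-bounded) ⟩
          0# + e * (ι m * α)        ≈⟨ +-identityˡ _ ⟩
          e * (ι m * α)             ∎)
          where
          Δ = e * ι n - e * (ι m * α)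
          Δ-bounded : ∀ T → ι T * Δ ≤ ι n * (ι m * β)
          Δ-bounded T = +-cancelʳ-≤ (ι m * α * (ι T * e)) (begin
            ι T * Δ + ι m * α * (ι T * e)         ≈⟨ solve 5 (λ t z m a e → t :* z :+ m :* a :* (t :* e) := t :* (z :+ e :* (m :* a)))
                                                       refl (ι T) Δ (ι m) α e ⟩
            ι T * (Δ + e * (ι m * α))             ≈⟨ *-congˡ (x-y+y≈x (e * ι n) (e * (ι m * α))) ⟩
            ι T * (e * ι n)                       ≈⟨ solve 3 (λ t e n → t :* (e :* n) := n :* (t :* e)) refl (ι T) e (ι n) ⟩
            ι n * (ι T * e)                       ≤⟨ cost-bound 1≤n T ⟩
            ι m * α * (ι T * e) + ι n * (ι m * β) ≈⟨ +-comm _ _ ⟩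
            ι n * (ι m * β) + ι m * α * (ι T * e) ∎)

  bits-lowerBound :
    ∀ (C : ℝ) → 0# < C → ∃ λ (C′ : ℝ) → 0# < C′ ×
      (∀ (n : ℕ) → 3 ℕ.≤ n → (M : FiniteMetricSpace n) (b : ℕ) →
        (∃ λ (A : BitAlgorithm M b) → IsCompetitive M b (C * log₂ (ι n) ^ 2) A) →
        log₂ (ι n) - C′ * log₂ (log₂ (ι n)) ≤ ι b)
  bits-lowerBound C (0≤C , _) with x≤2^k C
  -- Rounding `C` up to a power of two makes it a summand `K` of the exponent, which `log₂-bound`
  -- turns into the factor 2 + 2K.
  ... | K , C≤2^K = ι (2 ℕ.+ 2 ℕ.* K) , 0<ι {2 ℕ.+ 2 ℕ.* K} (ℕ.s≤s ℕ.z≤n) , λ n 3≤n M b (A , comp) →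
    let 0≤L² = ^-nonNeg (≤-trans 0≤1 (1≤log₂ 3≤n)) 2
        e , 0<e , e≤d = min-distance M in
    x≤y+z⇒x-z≤y (log₂-bound {n} {b} {K} 3≤n (begin
      ι n                                       ≤⟨ n≤2^b*α M 0<e e≤d {b} (*-nonNeg 0≤C 0≤L²) A comp (ℕ.≤-trans (ℕ.s≤s ℕ.z≤n) 3≤n) ⟩
      ι (2 ℕ.^ b) * (C * log₂ (ι n) ^ 2)        ≈⟨ *-congʳ (ι-^ 2 b) ⟩
      ι 2 ^ b * (C * log₂ (ι n) ^ 2)            ≤⟨ *-monoˡ-≤ (^-nonNeg 0≤2 b) (*-monoʳ-≤ 0≤L² C≤2^K) ⟩
      ι 2 ^ b * (ι 2 ^ K * log₂ (ι n) ^ 2)      ∎))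

-- Part (ii): configurations and transitions of the team

module UpperBound (lem : ExcludedMiddle 0ℓ) (R : CompleteOrderedField) where
  open MTS lem R
  open OrderedField lem R
  open ExtendedReals lem R
  open LowerBound lem R using (stepCost; stepCost-nonNeg)
  open ≤-Reasoning
  open CommutativeRing commutativeRing using (zeroʳ)
  open import Algebra.Properties.CommutativeMonoid.Sum +-commutativeMonoid
    using (sum; ∑-distrib-+; sum-cong-≗)
  open import Algebra.Solver.Ring.NaturalCoefficients.Default commutativeSemiring
    using (solve; _:+_; _:*_; _:=_; con)

  -- No minimising member is required: every real z below x makes (z - g)/a a lower bound of the
  -- family, hence at most its infimum. An infinite x fails at z = a * inf + g + 1.
  inf-affine : ∀ {I : Set} {f : I → ℝ⁺} {bdd a g x} → 0# < a →
               (∀ i {B} → f i ≤⁺ [ B ] → x ≤⁺ [ a * B + g ]) → x ≤⁺ a *⁺ inf f bdd +⁺ [ g ]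
  inf-affine {f = f} {bdd} {a} {g} {x} 0<a bound with inf f bdd in eq
  ... | ⊤⁺    = _ ≤⊤⁺
  ... | [ o ] = finish x below
    where
    below : ∀ z → [ z ] ≤⁺ x → z ≤ a * o + g
    below z z≤x = ≤-trans (≤-reflexive (sym (x-y+y≈x z g))) (+-monoˡ-≤ g (z⁻¹*x≤y⇒x≤z*y 0<a
      (AddSupremum.[≤]-injective _≤_ (≡.subst ([ a ⁻¹ * (z - g) ] ≤⁺_) eq (inf-greatest {f = f} {bdd} lower)))))
      where
      lower : IsLowerBound f (a ⁻¹ * (z - g))
      lower i with f i | bound i
      ... | ⊤⁺    | _ = _ ≤⊤⁺
      ... | [ B ] | b = [ x≤z*y⇒z⁻¹*x≤y 0<a (x≤y+z⇒x-z≤y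
                          (AddSupremum.[≤]-injective _≤_ (≤⁺-trans z≤x (b ≤⁺-refl)))) ]

    finish : ∀ x → (∀ z → [ z ] ≤⁺ x → z ≤ a * o + g) → x ≤⁺ [ a * o + g ]
    finish [ z ] below = [ below z ≤⁺-refl ]
    finish ⊤⁺    below = contradiction (below (a * o + g + 1#) (_ ≤⊤⁺)) x+1≰x

  module _ {n : ℕ} where

    unsaturated? : (a : Fin n → ℝ) → ∀ x → Dec (¬ (1# ≤ a x))
    unsaturated? a x = lem

    unsaturated : (Fin n → ℝ) → Subset n
    unsaturated a = comprehension (unsaturated? a)

    cheapest? : (c : Fin n → ℝ) → ∀ x → Dec (∀ y → c x ≤ c y)
    cheapest? c x = lem

    unsaturated-cong : ∀ {a a′ : Fin n → ℝ} → (∀ x → a x ≈ a′ x) → unsaturated a ≡ unsaturated a′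
    unsaturated-cong {a} {a′} a≈a′ = comprehension-cong (unsaturated? a) (unsaturated? a′) λ x → mk⇔
      (λ 1≰a 1≤a′ → 1≰a (≤-trans 1≤a′ (≤-reflexive (sym (a≈a′ x)))))
      (λ 1≰a′ 1≤a → 1≰a′ (≤-trans 1≤a (≤-reflexive (a≈a′ x))))

    ∈unsaturated⇒≤1 : ∀ {a x} → x ∈ unsaturated a → a x ≤ 1#
    ∈unsaturated⇒≤1 {a} {x} x∈ with total (a x) 1#
    ... | inj₁ a≤1 = a≤1
    ... | inj₂ 1≤a = contradiction 1≤a (∈-comprehension⁻ (unsaturated? a) x∈)

    empty⇒1≤ : ∀ {a} → ¬ Nonempty (unsaturated a) → ∀ x → 1# ≤ a x
    empty⇒1≤ {a} empty x with lem {1# ≤ a x}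
    ... | yes 1≤a = 1≤a
    ... | no  1≰a = contradiction (x , ∈-comprehension⁺ (unsaturated? a) 1≰a) empty

    unsaturated-antitone : ∀ {a a′} → (∀ x → a x ≤ a′ x) → unsaturated a′ ⊆ unsaturated a
    unsaturated-antitone {a} {a′} a≤a′ x∈ = ∈-comprehension⁺ (unsaturated? a)
      (λ 1≤a → ∈-comprehension⁻ (unsaturated? a′) x∈ (≤-trans 1≤a (a≤a′ _)))

  minimum : ∀ {n} (c : Fin (suc n) → ℝ) → ∃ λ x → ∀ y → c x ≤ c y
  minimum {zero}  c = zero , λ { zero → ≤-refl }
  minimum {suc n} c with minimum (c ∘ suc)
  ... | x , c≤ with total (c zero) (c (suc x))
  ...   | inj₁ c0≤ = zero , λ { zero → ≤-refl ; (suc y) → ≤-trans c0≤ (c≤ y) }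
  ...   | inj₂ ≤c0 = suc x , λ { zero → ≤c0 ; (suc y) → c≤ y }

  module _ {n : ℕ} where

    cheapest : (Fin (suc n) → ℝ) → Fin (suc n)
    cheapest c = first (comprehension (cheapest? c))

    cheapest-≤ : ∀ c y → c (cheapest c) ≤ c y
    cheapest-≤ c = ∈-comprehension⁻ (cheapest? c) (first-∈ _
      (proj₁ (minimum c) , ∈-comprehension⁺ (cheapest? c) (proj₂ (minimum c))))

    cheapest-cong : ∀ {c c′} → (∀ x → c x ≈ c′ x) → cheapest c ≡ cheapest c′
    cheapest-cong {c} {c′} c≈c′ = ≡.cong first (comprehension-cong (cheapest? c) (cheapest? c′) λ x → mk⇔
      (λ min y → ≤-trans (≤-reflexive (sym (c≈c′ x))) (≤-trans (min y) (≤-reflexive (c≈c′ y))))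
      (λ min y → ≤-trans (≤-reflexive (c≈c′ x)) (≤-trans (min y) (≤-reflexive (sym (c≈c′ y))))))

  module _ {n : ℕ} where

    load-replicate : ∀ k x → load {suc n} (replicate k nothing) x ≡ 0
    load-replicate zero    x = ≡.refl
    load-replicate (suc k) x = load-replicate k x

    vacant-replicate : ∀ k → vacant {suc n} (replicate k nothing) ≡ k
    vacant-replicate zero    = ≡.refl
    vacant-replicate (suc k) = ≡.cong suc (vacant-replicate k)

    vacant-map-just : ∀ {k} (w : Vec (Fin (suc n)) k) → vacant (map just w) ≡ 0
    vacant-map-just []      = ≡.refl
    vacant-map-just (x ∷ w) = vacant-map-just w

    -- Bounds what the agent has paid at its present state, since `acc` runs from the start of the
    -- phase and the agent may have come later.
    credit : (Fin (suc n) → ℝ) → Maybe (Fin (suc n)) → ℝ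
    credit a nothing  = 0#
    credit a (just x) = a x

    vacancy : Maybe (Fin (suc n)) → ℝ
    vacancy nothing  = 1#
    vacancy (just _) = 0#

    sum-vacancy : ∀ {k} (v : Assignment (suc n) k) → sum (λ s → vacancy (lookup v s)) ≈ ι (vacant v)
    sum-vacancy []            = refl
    sum-vacancy (nothing ∷ v) = +-congˡ (sum-vacancy v)
    sum-vacancy (just x ∷ v)  = trans (+-identityˡ _) (sum-vacancy v)

  -- The agents are the seeds. acc is the cost accumulated since the start of the
  -- phase; an agent is vacant from the end of a phase to the next step.
  record Configuration (n m : ℕ) : Set where
    field
      acc : Fin n → ℝ
      pos : Assignment n m
      out : Vec (Fin n) m

  open Configuration

  module _ {n m : ℕ} where

    private
      Conf = Configuration (suc n) m

    initial : Vec (Fin (suc n)) m → Conf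
    initial o = record { acc = λ _ → 0# ; pos = replicate m nothing ; out = o }

    -- If no state is left unsaturated, the phase ends within the step: all agents pay the current
    -- vector at `z`, and `pos` is emptied so that the next step places them afresh, while `out`
    -- remembers where they really are.
    advance : (Fin (suc n) → ℝ) → Subset (suc n) → Fin (suc n) → Assignment (suc n) m → Conf
    advance a p z v with nonempty? p
    ... | yes _ = record { acc = a ; pos = map just w ; out = w }
      where w = fill p (quota m ∣ p ∣) (λ _ → 0) (map (keep p) v)
    ... | no  _ = initial (replicate m z)

    next : Conf → (Fin (suc n) → ℝ) → Conf
    next σ c = advance a (unsaturated a) (cheapest c) (pos σ)
      where a = λ x → acc σ x + c x

    infix 4 _∼_
    _∼_ : Conf → Conf → Set
    σ ∼ σ′ = (∀ x → acc σ x ≈ acc σ′ x) × pos σ ≡ pos σ′ × out σ ≡ out σ′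

    advance-cong : ∀ {a a′ p p′ z z′ v v′} → (∀ x → a x ≈ a′ x) → p ≡ p′ → z ≡ z′ → v ≡ v′ →
                   advance a p z v ∼ advance a′ p′ z′ v′
    advance-cong {p = p} a≈a′ ≡.refl ≡.refl ≡.refl with nonempty? p
    ... | yes _ = a≈a′ , ≡.refl , ≡.refl
    ... | no  _ = (λ _ → refl) , ≡.refl , ≡.refl

    next-cong : ∀ {σ σ′ c c′} → σ ∼ σ′ → (∀ x → c x ≈ c′ x) → next σ c ∼ next σ′ c′
    next-cong (acc≈ , pos≡ , _) c≈ = advance-cong (λ x → +-cong (acc≈ x) (c≈ x))
      (unsaturated-cong (λ x → +-cong (acc≈ x) (c≈ x))) (cheapest-cong c≈) pos≡

    record Valid (σ : Conf) : Set where
      field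
        acc-nonNeg : ∀ x → 0# ≤ acc σ x
        within     : pos σ Within unsaturated (acc σ)
        load≤quota : ∀ x → x ∈ unsaturated (acc σ) → load (pos σ) x ℕ.≤ quota m ∣ unsaturated (acc σ) ∣
        pos⇒out    : ∀ s {x} → lookup (pos σ) s ≡ just x → lookup (out σ) s ≡ x

    initial-pos : ∀ {s : Fin m} {x : Fin (suc n)} → ¬ (lookup (replicate m nothing) s ≡ just x)
    initial-pos {s} eq with ≡.trans (≡.sym (lookup-replicate s nothing)) eq
    ... | ()

    initial-valid : ∀ o → Valid (initial o)
    initial-valid o = record
      { acc-nonNeg = λ _ → ≤-refl
      ; within     = λ s eq → contradiction eq (initial-pos {s})
      ; load≤quota = λ x _ → ℕ.≤-trans (ℕ.≤-reflexive (load-replicate m x)) ℕ.z≤n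
      ; pos⇒out    = λ s eq → contradiction eq (initial-pos {s})
      }

    -- Covers the moves still to come before the phase ends: those of the vacant agents and those
    -- forced by later saturations. The move ending the phase is accounted for in `end-total`.
    pendingMoves : Conf → ℕ
    pendingMoves σ = vacant (pos σ) ℕ.+ moveBound m ∣ unsaturated (acc σ) ∣

    initial-pendingMoves : ∀ o → pendingMoves (initial o) ℕ.≤ m ℕ.+ moveBound m (suc n)
    initial-pendingMoves o = ℕ.+-mono-≤ (ℕ.≤-reflexive (vacant-replicate m))
      (moveBound-mono m (∣p∣≤n (unsaturated (acc (initial o)))))

    totalCredit : Conf → ℝ
    totalCredit σ = sum (λ s → credit (acc σ) (lookup (pos σ) s))


  -- Amortised cost of one step

  module Step {n m : ℕ} (dist : Fin (suc n) → Fin (suc n) → ℝ)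
              (dist-refl : ∀ x → dist x x ≤ 0#) (dist≤1 : ∀ x y → dist x y ≤ 1#) where

    private
      Conf = Configuration (suc n) m

    double : ℝ → ℝ
    double x = x + x

    stepSum : Conf → (Fin (suc n) → ℝ) → Conf → ℝ
    stepSum σ c σ′ = sum (λ s → dist (lookup (out σ) s) (lookup (out σ′) s) + c (lookup (out σ′) s))

    -- Amortisation: a continuing step costs at most the rise of the credit plus twice the drop of
    -- `pendingMoves`. At the end of a phase the old credit, at most 1 per agent, is written off and
    -- the potential starts anew. All terms are arranged to avoid subtraction.
    data Outcome (σ : Conf) (c : Fin (suc n) → ℝ) (σ′ : Conf) : Set where
      continues : (∀ x → acc σ′ x ≡ acc σ x + c x) →
                  stepSum σ c σ′ + totalCredit σ + double (ι (pendingMoves σ′)) ≤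
                    totalCredit σ′ + double (ι (pendingMoves σ)) →
                  Outcome σ c σ′
      ends      : (∀ x → acc σ′ x ≡ 0#) → (∀ x → 1# ≤ acc σ x + c x) →
                  ∀ {μ} → 0# ≤ μ → (∀ x → μ ≤ c x) →
                  stepSum σ c σ′ + totalCredit σ + double (ι (pendingMoves σ′)) ≤
                    ι m * (double 1# + μ) + double (ι (m ℕ.+ moveBound m (suc n))) →
                  Outcome σ c σ′

    double-mono : ∀ {x y} → x ≤ y → double x ≤ double y
    double-mono x≤y = +-mono-≤ x≤y x≤y

    credit≤1 : ∀ {σ : Conf} → Valid σ → ∀ s → credit (acc σ) (lookup (pos σ) s) ≤ 1#
    credit≤1 {σ} valid s with lookup (pos σ) s in eq
    ... | nothing = 0≤1
    ... | just x  = ∈unsaturated⇒≤1 {a = acc σ} (Valid.within valid s eq)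

    totalCredit≤m : ∀ {σ : Conf} → Valid σ → totalCredit σ ≤ ι m
    totalCredit≤m {σ} valid = begin
      totalCredit σ        ≤⟨ sum-mono-≤ (credit≤1 valid) ⟩
      sum {m} (λ _ → 1#)   ≈⟨ sum-const m 1# ⟩
      ι m * 1#             ≈⟨ *-identityʳ (ι m) ⟩
      ι m                  ∎

    module _ {σ : Conf} {c : Fin (suc n) → ℝ} (valid : Valid σ) (0≤c : ∀ x → 0# ≤ c x) where

      open Valid valid

      private
        a′ : Fin (suc n) → ℝ
        a′ x = acc σ x + c x
        p = unsaturated (acc σ)
        p′ = unsaturated a′
        v = map (keep p′) (pos σ)
        w = fill p′ (quota m ∣ p′ ∣) (λ _ → 0) v

        p′⊆p : p′ ⊆ p
        p′⊆p = unsaturated-antitone {a = acc σ} {a′ = a′} (λ x → x≤x+y (acc σ x) (0≤c x))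

      module Continue (ne : Nonempty p′) where

        σ′ : Conf
        σ′ = record { acc = a′ ; pos = map just w ; out = w }

        instance
          ∣p′∣≢0 : ℕ.NonZero ∣ p′ ∣
          ∣p′∣≢0 = ℕ.>-nonZero (ℕ.≤-<-trans ℕ.z≤n (x∈p⇒∣p-x∣<∣p∣ (proj₂ ne)))

        v⊆p′ : v Within p′
        v⊆p′ s eq = proj₂ (keep-just p′ (lookup (pos σ) s)
          (≡.trans (≡.sym (lookup-map s (keep p′) (pos σ))) eq))

        filling : IsFilling p′ (quota m ∣ p′ ∣) (λ _ → 0) v w
        filling = fill-isFilling p′ _ _ v v⊆p′
          (λ x x∈p′ → ℕ.≤-trans (load-keep p′ (pos σ) x) (ℕ.≤-trans (load≤quota x (p′⊆p x∈p′))
            (quota-antitone m (p⊆q⇒∣p∣≤∣q∣ p′⊆p))))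
          (ℕ.≤-trans (ℕ.≤-reflexive (≡.cong (ℕ._+ m) (sumOver-0 p′))) (quota-capacity m ∣ p′ ∣))

        map-just : ∀ s {x} → lookup (map just w) s ≡ just x → lookup w s ≡ x
        map-just s eq with ≡.trans (≡.sym (lookup-map s just w)) eq
        ... | ≡.refl = ≡.refl

        valid′ : Valid σ′
        valid′ = record
          { acc-nonNeg = λ x → +-nonNeg (acc-nonNeg x) (0≤c x)
          ; within     = λ s eq → ≡.subst (_∈ p′) (map-just s eq) (IsFilling.within filling s)
          ; load≤quota = IsFilling.load≤ filling
          ; pos⇒out    = map-just
          }

        -- A kept agent does not move, and its credit rises by just what it pays. A newly placed
        -- agent pays at most 1 for moving, and its new credit covers the entry at its new state. If
        -- it had to leave a state, the credit lost is at most 1, as that state was unsaturated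
        -- before the step.
        agent : ∀ s → (dist (lookup (out σ) s) (lookup w s) + c (lookup w s))
                      + credit (acc σ) (lookup (pos σ) s) ≤
                      credit a′ (lookup (map just w) s) + double (vacancy (lookup v s))
        agent s rewrite lookup-map s just w with lookup (pos σ) s in eq | lookup v s in eq′
                                             | lookup-map s (keep p′) (pos σ)
        ... | nothing | _ | ≡.refl = begin
          (dist o y + c y) + 0#        ≈⟨ +-identityʳ _ ⟩
          dist o y + c y               ≤⟨ +-mono-≤ (dist≤1 o y) (y≤x+y (c y) (acc-nonNeg y)) ⟩
          1# + a′ y                    ≤⟨ y≤x+y _ 0≤1 ⟩
          1# + (1# + a′ y)             ≈⟨ solve 2 (λ i a → i :+ (i :+ a) := a :+ (i :+ i)) refl 1# (a′ y) ⟩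
          a′ y + double 1#             ∎
          where
          o = lookup (out σ) s
          y = lookup w s
        ... | just x | just _ | eq″ with keep-just p′ (just x) (≡.sym eq″)
        ...   | ≡.refl , x∈p′ = begin
          (dist o y + c y) + acc σ x   ≡⟨ ≡.cong₂ (λ o y → (dist o y + c y) + acc σ x)
                                            (pos⇒out s eq) (IsFilling.unmoved filling s eq′) ⟩
          (dist x x + c x) + acc σ x   ≤⟨ +-monoˡ-≤ _ (+-monoˡ-≤ _ (dist-refl x)) ⟩
          (0# + c x) + acc σ x         ≈⟨ solve 2 (λ c a → (con 0 :+ c) :+ a := (a :+ c) :+ (con 0 :+ con 0)) refl (c x) (acc σ x) ⟩
          a′ x + double 0#             ≡⟨ ≡.cong (λ y → a′ y + double 0#) (IsFilling.unmoved filling s eq′) ⟨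
          a′ y + double 0#             ∎
          where
          o = lookup (out σ) s
          y = lookup w s
        agent s | just x | nothing | _ = begin
          (dist o y + c y) + acc σ x   ≤⟨ +-mono-≤ (+-mono-≤ (dist≤1 o y) (y≤x+y (c y) (acc-nonNeg y)))
                                            (∈unsaturated⇒≤1 {a = acc σ} (within s eq)) ⟩
          (1# + a′ y) + 1#             ≈⟨ solve 2 (λ i a → i :+ a :+ i := a :+ (i :+ i)) refl 1# (a′ y) ⟩
          a′ y + double 1#             ∎
          where
          o = lookup (out σ) s
          y = lookup w s

        continue-total : stepSum σ c σ′ + totalCredit σ + double (ι (pendingMoves σ′)) ≤
                         totalCredit σ′ + double (ι (pendingMoves σ))
        continue-total = begin
          stepSum σ c σ′ + totalCredit σ + double (ι (pendingMoves σ′))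
            ≤⟨ +-monoˡ-≤ _ (begin
              stepSum σ c σ′ + totalCredit σ
                ≈⟨ ∑-distrib-+ {m} _ _ ⟨
              sum (λ s → (dist (lookup (out σ) s) (lookup w s) + c (lookup w s)) + credit (acc σ) (lookup (pos σ) s))
                ≤⟨ sum-mono-≤ agent ⟩
              sum (λ s → credit a′ (lookup (map just w) s) + double (vacancy (lookup v s)))
                ≈⟨ trans (∑-distrib-+ {m} _ _) (+-congˡ (∑-distrib-+ {m} _ _)) ⟩
              totalCredit σ′ + double (sum (λ s → vacancy (lookup v s)))
                ≈⟨ +-congˡ (+-cong (sum-vacancy v) (sum-vacancy v)) ⟩
              totalCredit σ′ + double (ι (vacant v)) ∎) ⟩
          totalCredit σ′ + double (ι (vacant v)) + double (ι (pendingMoves σ′))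
            ≈⟨ solve 3 (λ t v q → t :+ (v :+ v) :+ (q :+ q) := t :+ ((v :+ q) :+ (v :+ q)))
                 refl (totalCredit σ′) (ι (vacant v)) (ι (pendingMoves σ′)) ⟩
          totalCredit σ′ + double (ι (vacant v) + ι (pendingMoves σ′))
            ≤⟨ +-monoʳ-≤ _ (double-mono (≤-trans (≤-reflexive (sym (ι-+ (vacant v) (pendingMoves σ′)))) (ι-mono-≤ moves))) ⟩
          totalCredit σ′ + double (ι (pendingMoves σ)) ∎
          where
          -- Filling leaves nobody vacant, so the potential releases the `vacant v` moves made in
          -- this step.
          moves : vacant v ℕ.+ pendingMoves σ′ ℕ.≤ pendingMoves σ
          moves = ℕ.≤-trans
            (ℕ.≤-reflexive (≡.cong (λ i → vacant v ℕ.+ (i ℕ.+ moveBound m ∣ p′ ∣)) (vacant-map-just w)))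
            (vacant-keep-moveBound m p p′ (pos σ) within p′⊆p load≤quota)

      end-total : ∀ z → let σ′ = initial {m = m} (replicate m z) in
                  stepSum σ c σ′ + totalCredit σ + double (ι (pendingMoves σ′)) ≤
                    ι m * (double 1# + c z) + double (ι (m ℕ.+ moveBound m (suc n)))
      end-total z = +-mono-≤ (begin
          stepSum σ c σ′ + totalCredit σ
            ≈⟨ ∑-distrib-+ {m} _ _ ⟨
          sum (λ s → (dist (lookup (out σ) s) (lookup (out σ′) s) + c (lookup (out σ′) s))
                     + credit (acc σ) (lookup (pos σ) s))
            ≤⟨ sum-mono-≤ (λ s → begin
              (dist _ (lookup (out σ′) s) + c (lookup (out σ′) s)) + credit (acc σ) (lookup (pos σ) s)
                ≤⟨ +-mono-≤ (+-mono-≤ (dist≤1 _ _) (≤-reflexive (reflexive (≡.cong c (lookup-replicate s z)))))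
                     (credit≤1 valid s) ⟩
              (1# + c z) + 1#
                ≈⟨ solve 2 (λ i c → i :+ c :+ i := i :+ i :+ c) refl 1# (c z) ⟩
              double 1# + c z ∎) ⟩
          sum {m} (λ _ → double 1# + c z)
            ≈⟨ sum-const m _ ⟩
          ι m * (double 1# + c z) ∎)
        (double-mono (ι-mono-≤ (initial-pendingMoves {n} {m} (out σ′))))
        where σ′ = initial {m = m} (replicate m z)

      next-valid : Valid (next σ c)
      next-valid with nonempty? p′
      ... | yes ne = Continue.valid′ ne
      ... | no  _  = initial-valid _

      next-outcome : Outcome σ c (next σ c)
      next-outcome with nonempty? p′
      ... | yes ne = continues (λ _ → ≡.refl) (Continue.continue-total ne)
      ... | no  em = ends (λ _ → ≡.refl) (empty⇒1≤ {a = a′} em) (0≤c (cheapest c)) (cheapest-≤ c)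
                       (end-total (cheapest c))

    -- `D` covers a phase of the whole team up to its last cost vector; the share `m * μ` of that
    -- vector is covered by `D * μ`.
    module _ (dist-nonNeg : ∀ x y → 0# ≤ dist x y) (1≤dist : ∀ x y → x ≢ y → 1# ≤ dist x y)
             {D : ℝ} (m≤D : ι m ≤ D) (phase≤D : ι m * double 1# + double (ι (m ℕ.+ moveBound m (suc n))) ≤ D) where

      -- charge is the sum of 1 + min c over the final cost vectors c of the
      -- completed phases. Twice the cost of any other schedule, at x now, pays for it.
      record Progress (σ : Conf) (algorithmCost scheduleCost : ℝ) (x : Fin (suc n)) : Set where
        field
          charge      : ℝ
          charge≤     : charge ≤ double scheduleCost
          phaseCharge : charge + double 1# ≤ double scheduleCost ⊎
                        charge + double (acc σ x) ≤ double scheduleCost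
          algorithm≤  : algorithmCost + double (ι (pendingMoves σ)) ≤ D * charge + D + totalCredit σ

      0≤D : 0# ≤ D
      0≤D = ≤-trans (0≤ι m) m≤D

      initial-progress : ∀ o x → Progress (initial o) 0# 0# x
      initial-progress o x = record
        { charge      = 0#
        ; charge≤     = ≤-reflexive (sym (+-identityˡ 0#))
        ; phaseCharge = inj₂ (≤-reflexive (+-identityˡ (double 0#)))
        ; algorithm≤  = begin
            0# + double (ι (pendingMoves (initial o)))  ≈⟨ +-identityˡ _ ⟩
            double (ι (pendingMoves (initial o)))       ≤⟨ double-mono (ι-mono-≤ (initial-pendingMoves o)) ⟩
            double (ι (m ℕ.+ moveBound m (suc n)))      ≤⟨ y≤x+y _ (*-nonNeg (0≤ι m) (+-nonNeg 0≤1 0≤1)) ⟩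
            ι m * double 1# + double (ι (m ℕ.+ moveBound m (suc n)))  ≤⟨ phase≤D ⟩
            D                                           ≤⟨ y≤x+y D (≤-reflexive (sym (zeroʳ D))) ⟩
            D * 0# + D                                  ≤⟨ x≤x+y _ (initial-credit m) ⟩
            D * 0# + D + totalCredit (initial o)        ∎
        }
        where
        initial-credit : ∀ k → 0# ≤ sum (λ s → credit (λ _ → 0#) (lookup (replicate k nothing) s))
        initial-credit zero    = ≤-refl
        initial-credit (suc k) = +-nonNeg ≤-refl (initial-credit k)

      module _ {σ : Conf} {c : Fin (suc n) → ℝ} (valid : Valid σ) (0≤c : ∀ x → 0# ≤ c x)
               {A O x} (progress : Progress σ A O x) (y : Fin (suc n)) where

        open Progress progress

        private
          σ′ = next σ c
          step = dist x y + c y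

          0≤step : 0# ≤ step
          0≤step = +-nonNeg (dist-nonNeg x y) (0≤c y)

          O≤ : double O ≤ double (O + step)
          O≤ = double-mono (x≤x+y O 0≤step)

          double-O : ∀ {u v} → u ≤ double O → v ≤ double step → u + v ≤ double (O + step)
          double-O {u} {v} u≤ v≤ = begin
            u + v                   ≤⟨ +-mono-≤ u≤ v≤ ⟩
            double O + double step  ≈⟨ solve 2 (λ o s → o :+ o :+ (s :+ s) := o :+ s :+ (o :+ s)) refl O step ⟩
            double (O + step)       ∎

          c≤step : c y ≤ step
          c≤step = y≤x+y (c y) (dist-nonNeg x y)

        -- The alternative records whether the schedule has moved in this phase. A move costs at
        -- least 1, which doubled pays the 2; a schedule that stays has paid all of `acc` at its
        -- state.
        phaseCharge-continues : charge + double 1# ≤ double (O + step) ⊎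
                                charge + double (acc σ y + c y) ≤ double (O + step)
        phaseCharge-continues with lem {x ≡ y} | phaseCharge
        ... | no  x≢y    | _          = inj₁ (double-O charge≤
          (double-mono (≤-trans (1≤dist x y x≢y) (x≤x+y _ (0≤c y)))))
        ... | yes _      | inj₁ paid  = inj₁ (≤-trans paid O≤)
        ... | yes ≡.refl | inj₂ paid  = inj₂ (begin
          charge + double (acc σ x + c x)           ≈⟨ solve 3 (λ q a c → q :+ (a :+ c :+ (a :+ c)) := (q :+ (a :+ a)) :+ (c :+ c))
                                                         refl charge (acc σ x) (c x) ⟩
          (charge + double (acc σ x)) + double (c x) ≤⟨ double-O paid (double-mono c≤step) ⟩
          double (O + step)                         ∎)

        -- A move in the last step pays 1, and its entry pays μ. After an earlier move only μ is
        -- missing. Without a move, `acc σ x + c x` is at least 1, and the same `c x` is used again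
        -- for μ: hence the doubling.
        phaseCharge-ends : (∀ z → 1# ≤ acc σ z + c z) → ∀ {μ} → (∀ z → μ ≤ c z) →
                           charge + (1# + μ) ≤ double (O + step)
        phaseCharge-ends 1≤ {μ} μ≤c with lem {x ≡ y} | phaseCharge
        ... | no  x≢y    | _          = double-O charge≤
          (+-mono-≤ (≤-trans (1≤dist x y x≢y) (x≤x+y _ (0≤c y))) (≤-trans (μ≤c y) c≤step))
        ... | yes _      | inj₁ paid  = begin
          charge + (1# + μ)                         ≤⟨ +-monoʳ-≤ charge (+-mono-≤ (x≤x+y 1# 0≤1) (≤-trans (μ≤c y) c≤step)) ⟩
          charge + (double 1# + step)               ≈⟨ +-assoc _ _ _ ⟨
          charge + double 1# + step                 ≤⟨ double-O paid (x≤x+y step 0≤step) ⟩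
          double (O + step)                         ∎
        ... | yes ≡.refl | inj₂ paid  = begin
          charge + (1# + μ)                         ≤⟨ +-monoʳ-≤ charge (+-mono-≤ (1≤ x) (μ≤c x)) ⟩
          charge + (acc σ x + c x + c x)            ≤⟨ x≤x+y _ (Valid.acc-nonNeg valid x) ⟩
          charge + (acc σ x + c x + c x) + acc σ x  ≈⟨ solve 3 (λ q a c → q :+ (a :+ c :+ c) :+ a := (q :+ (a :+ a)) :+ (c :+ c))
                                                         refl charge (acc σ x) (c x) ⟩
          (charge + double (acc σ x)) + double (c x) ≤⟨ double-O paid (double-mono c≤step) ⟩
          double (O + step)                         ∎

        next-progress : Progress σ′ (A + stepSum σ c σ′) (O + step) y
        next-progress with next-outcome valid 0≤c
        ... | continues acc≡ sum≤ = record
          { charge      = charge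
          ; charge≤     = ≤-trans charge≤ O≤
          ; phaseCharge = ≡.subst (λ a → charge + double 1# ≤ double (O + step) ⊎
                                         charge + double a ≤ double (O + step)) (≡.sym (acc≡ y)) phaseCharge-continues
          -- The old potentials are added on both sides and cancelled, since the solver works in a
          -- semiring.
          ; algorithm≤  = +-cancelʳ-≤ Ψ (+-cancelʳ-≤ 2Φ (begin
              A + S + 2Φ′ + Ψ + 2Φ                ≈⟨ solve 5 (λ a s f p g → a :+ s :+ f :+ p :+ g := (a :+ g) :+ (s :+ p :+ f))
                                                       refl A S 2Φ′ Ψ 2Φ ⟩
              (A + 2Φ) + (S + Ψ + 2Φ′)            ≤⟨ +-mono-≤ algorithm≤ sum≤ ⟩
              (D * charge + D + Ψ) + (Ψ′ + 2Φ)    ≈⟨ solve 4 (λ b p q g → b :+ p :+ (q :+ g) := b :+ q :+ p :+ g)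
                                                       refl (D * charge + D) Ψ Ψ′ 2Φ ⟩
              D * charge + D + Ψ′ + Ψ + 2Φ        ∎))
          }
          where
          S = stepSum σ c σ′
          Ψ = totalCredit σ
          Ψ′ = totalCredit σ′
          2Φ = double (ι (pendingMoves σ))
          2Φ′ = double (ι (pendingMoves σ′))
        ... | ends acc≡ 1≤ {μ} 0≤μ μ≤c sum≤ = record
          { charge      = charge + (1# + μ)
          ; charge≤     = phaseCharge-ends 1≤ μ≤c
          ; phaseCharge = inj₂ (≤-trans (≤-reflexive (trans (+-congˡ (trans
                              (reflexive (≡.cong double (acc≡ y))) (+-identityʳ 0#))) (+-identityʳ _)))
                            (phaseCharge-ends 1≤ μ≤c))
          ; algorithm≤  = +-cancelʳ-≤ Ψ (begin
              A + S + 2Φ′ + Ψ                        ≈⟨ solve 4 (λ a s f p → a :+ s :+ f :+ p := a :+ (s :+ p :+ f))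
                                                          refl A S 2Φ′ Ψ ⟩
              A + (S + Ψ + 2Φ′)                      ≤⟨ +-mono-≤ (≤-trans (x≤x+y A 0≤2Φ) algorithm≤) sum≤ ⟩
              (D * charge + D + Ψ) + (ι m * (double 1# + μ) + 2Φ₀)
                                                     ≈⟨ solve 5 (λ b p m u f → b :+ p :+ (m :* (con 2 :+ u) :+ f)
                                                                  := b :+ (m :* con 2 :+ f :+ m :* u) :+ p)
                                                          refl (D * charge + D) Ψ (ι m) μ 2Φ₀ ⟩
              (D * charge + D) + (ι m * double 1# + 2Φ₀ + ι m * μ) + Ψ
                                                     -- The phase itself costs `D` and its last
                                                     -- vector `D * μ`: exactly `D` times the new
                                                     -- charge 1 + μ.
                                                     ≤⟨ +-monoˡ-≤ Ψ (+-monoʳ-≤ _ (+-mono-≤ phase≤D (*-monoʳ-≤ 0≤μ m≤D))) ⟩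
              (D * charge + D) + (D + D * μ) + Ψ     ≈⟨ solve 4 (λ d q u p → (d :* q :+ d) :+ (d :+ d :* u) :+ p
                                                                  := d :* (q :+ (con 1 :+ u)) :+ d :+ p)
                                                          refl D charge μ Ψ ⟩
              D * (charge + (1# + μ)) + D + Ψ        ≤⟨ +-monoˡ-≤ Ψ (x≤x+y _ 0≤Ψ′) ⟩
              D * (charge + (1# + μ)) + D + Ψ′ + Ψ   ∎)
          }
          where
          S = stepSum σ c σ′
          Ψ = totalCredit σ
          Ψ′ = totalCredit σ′
          0≤2Φ = +-nonNeg (0≤ι (pendingMoves σ)) (0≤ι (pendingMoves σ))
          2Φ′ = double (ι (pendingMoves σ′))
          2Φ₀ = double (ι (m ℕ.+ moveBound m (suc n)))

          credit-nonNeg : ∀ a → 0# ≤ credit (acc σ′) a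
          credit-nonNeg nothing  = ≤-refl
          credit-nonNeg (just z) = ≤-reflexive (reflexive (≡.sym (acc≡ z)))

          0≤Ψ′ : 0# ≤ Ψ′
          0≤Ψ′ = ≤-trans (≤-reflexive (sym (trans (sum-const m 0#) (zeroʳ (ι m)))))
                         (sum-mono-≤ {f = λ _ → 0#} (λ s → credit-nonNeg (lookup (pos σ′) s)))

      progress⇒≤ : ∀ {σ A O x} → Valid σ → Progress σ A O x → A ≤ D * double O + double D
      progress⇒≤ {σ} {A} {O} valid progress = begin
        A                                     ≤⟨ x≤x+y A (+-nonNeg (0≤ι (pendingMoves σ)) (0≤ι (pendingMoves σ))) ⟩
        A + double (ι (pendingMoves σ))       ≤⟨ algorithm≤ ⟩
        D * charge + D + totalCredit σ        ≤⟨ +-mono-≤ (+-monoˡ-≤ D (*-monoˡ-≤ 0≤D charge≤))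
                                                   (≤-trans (totalCredit≤m valid) m≤D) ⟩
        D * double O + D + D                  ≈⟨ +-assoc _ D D ⟩
        D * double O + double D               ∎
        where open Progress progress

  -- The algorithm on a uniform space and its expected cost

  module Collective {n : ℕ} (M : FiniteMetricSpace (suc n)) (uniform : IsUniform M) (m : ℕ) where

    open FiniteMetricSpace M
    open IsGeneralMetric isMetric using (nonNegative; ≈⇒0)
    open Inverse enumeration using (to; from; strictlyInverseˡ; strictlyInverseʳ)

    private
      Conf = Configuration (suc n) m

    dist : Fin (suc n) → Fin (suc n) → ℝ
    dist x y = d (to x) (to y)

    1≤dist : ∀ x y → x ≢ y → 1# ≤ dist x y
    1≤dist x y x≢y = ≤-reflexive (sym (uniform (to x) (to y) λ eq →
      x≢y (≡.trans (≡.sym (strictlyInverseʳ x)) (≡.trans (≡.cong from eq) (strictlyInverseʳ y)))))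

    dist≤1 : ∀ x y → dist x y ≤ 1#
    dist≤1 x y with lem {to x ≡ to y}
    ... | yes eq = ≤-trans (≤-reflexive (≈⇒0 eq)) 0≤1
    ... | no  ≢  = ≤-reflexive (uniform (to x) (to y) ≢)

    open Step {n} {m} dist (λ x → ≤-reflexive (≈⇒0 ≡.refl)) dist≤1

    costs : CostVector M → Fin (suc n) → ℝ
    costs c x = proj₁ (c (to x))

    origin : Conf
    origin = initial (replicate m zero)

    update : Conf → CostVector M → Conf
    update σ c = next σ (costs c)

    algorithm : Algorithm M (Fin m)
    algorithm = record
      { state      = λ cs s → to (lookup (out (foldl update origin cs)) s)
      ; state-cong = λ cs≋ s → ≡.cong (λ o → to (lookup o s))
                       (proj₂ (proj₂ (foldl-cong cs≋ ((λ _ → refl) , ≡.refl , ≡.refl))))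
      }
      where
      foldl-cong : ∀ {cs cs′} → Pointwise (_≋_ M) cs cs′ → ∀ {σ σ′} → σ ∼ σ′ →
                   foldl update σ cs ∼ foldl update σ′ cs′
      foldl-cong []          σ∼ = σ∼
      foldl-cong (c≋ ∷ cs≋) σ∼ = foldl-cong cs≋ (next-cong σ∼ (λ x → c≋ (to x)))

    open Algorithm algorithm

    module _ (c : CostSequence M) where

      run : ℕ → Conf
      run zero    = origin
      run (suc t) = update (run t) (c t)

      foldl-applyUpTo : ∀ t → foldl update origin (applyUpTo c t) ≡ run t
      foldl-applyUpTo zero    = ≡.refl
      foldl-applyUpTo (suc t) = ≡.trans (≡.cong (foldl update origin) (≡.sym (applyUpTo-∷ʳ c t)))
        (≡.trans (foldl-∷ʳ update origin (c t) (applyUpTo c t))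
          (≡.cong (λ σ → update σ (c t)) (foldl-applyUpTo t)))

      output≡ : ∀ s t → output c s t ≡ to (lookup (out (run t)) s)
      output≡ s t = ≡.cong (λ σ → to (lookup (out σ) s)) (foldl-applyUpTo t)

      run-valid : ∀ t → Valid (run t)
      run-valid zero    = initial-valid _
      run-valid (suc t) = next-valid (run-valid t) (λ x → proj₂ (c t (to x)))

      agentCost : Fin m → ℕ → ℝ
      agentCost s = stepCost M (output c s) c

      sum-agentCost : ∀ t → sum (λ s → agentCost s t) ≡ stepSum (run t) (costs (c t)) (run (suc t))
      sum-agentCost t = sum-cong-≗ λ s →
        ≡.cong₂ (λ x y → d x y + proj₁ (c t y)) (output≡ s t) (output≡ s (suc t))

      module _ {D : ℝ} (m≤D : ι m ≤ D)
               (phase≤D : ι m * double 1# + double (ι (m ℕ.+ moveBound m (suc n))) ≤ D) where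

        -- `Progress` speaks of indices and of the team as a whole, hence the detour through reals
        -- equal to the two costs. The schedule may start anywhere, since initial progress holds at
        -- each state.
        run-progress : ∀ ρ t → ∃ λ A → ∃ λ O →
          A ≈ sum (λ s → partialSum (agentCost s) t) × O ≈ partialSum (stepCost M ρ c) t ×
          Progress (λ _ _ → nonNegative) 1≤dist m≤D phase≤D (run t) A O (from (ρ t))
        run-progress ρ zero    = 0# , 0# , sym (trans (sum-const m 0#) (zeroʳ (ι m))) , refl ,
          initial-progress (λ _ _ → nonNegative) 1≤dist m≤D phase≤D _ _
        run-progress ρ (suc t) with run-progress ρ t
        ... | A , O , A≈ , O≈ , progress = _ , _ ,
          trans (+-cong A≈ (reflexive (≡.sym (sum-agentCost t)))) (sym (partialSum-sum agentCost t)) ,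
          +-cong O≈ (reflexive (≡.cong₂ (λ x y → d x y + proj₁ (c t y))
                                        (strictlyInverseˡ (ρ t)) (strictlyInverseˡ (ρ (suc t))))) ,
          next-progress (λ _ _ → nonNegative) 1≤dist m≤D phase≤D
            (run-valid t) (λ x → proj₂ (c t (to x))) progress (from (ρ (suc t)))

        algorithm-cost : ∀ ρ {B} → Cost M ρ c ≤⁺ [ B ] →
                         sum⁺ (λ s → Cost M (output c s) c) ≤⁺ [ D * double B + double D ]
        algorithm-cost ρ {B} cost≤B = sum⁺-series-≤ agentCost
          (λ s → stepCost-nonNeg M (output c s) c) bound
          where
          bound : ∀ T → sum (λ s → partialSum (agentCost s) T) ≤ D * double B + double D
          bound T with run-progress ρ T
          ... | A , O , A≈ , O≈ , progress = begin
            sum (λ s → partialSum (agentCost s) T) ≈⟨ A≈ ⟨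
            A                                      ≤⟨ progress⇒≤ (λ _ _ → nonNegative) 1≤dist m≤D phase≤D (run-valid T) progress ⟩
            D * double O + double D                ≤⟨ +-monoˡ-≤ _ (*-monoˡ-≤ (≤-trans (0≤ι m) m≤D) (double-mono O≤B)) ⟩
            D * double B + double D                ∎
            where
            O≤B : O ≤ B
            O≤B = ≤-trans (≤-reflexive O≈) (AddSupremum.[≤]-injective _≤_
              (≤⁺-trans (partialSum≤⁺series (stepCost M ρ c) T) cost≤B))

  ⌈log₂⌉≤2*log₂ : ∀ {n} → 2 ℕ.≤ n → ι ⌈log₂ n ⌉ ≤ ι 2 * log₂ (ι n)
  ⌈log₂⌉≤2*log₂ {n} 2≤n = ≤-trans (log₂-isBound (1≤ι (ℕ.<⇒≤ 2≤n)) ⌈log₂ n ⌉ 0 1 (begin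
    ι 2 ^ ⌈log₂ n ⌉      ≈⟨ ι-^ 2 ⌈log₂ n ⌉ ⟨
    ι (2 ℕ.^ ⌈log₂ n ⌉)  ≤⟨ ι-mono-≤ (2^⌈log₂n⌉≤n*n n 2≤n) ⟩
    ι (n ℕ.* n)          ≈⟨ ι-* n n ⟩
    ι n * ι n            ≈⟨ solve 1 (λ n → n :* n := con 1 :* (n :* (n :* con 1))) refl (ι n) ⟩
    1# * ι n ^ 2         ∎)) (≤-reflexive (+-identityˡ _))

  collective-competitive :
    ∃ λ (C″ : ℝ) → 0# < C″ ×
      (∀ (n : ℕ) → 2 ℕ.≤ n → (M : FiniteMetricSpace n) → IsUniform M →
        ∃ λ (A : BitAlgorithm M ⌈log₂ n ⌉) →
          IsCompetitive M ⌈log₂ n ⌉ (C″ * log₂ (ι n)) A)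
  -- 40 = 2 * 10 * 2: twice the cost of the schedule, the factor of `phase-bound`, and ⌈log n⌉ ≤ 2
  -- log n.
  collective-competitive = ι 40 , 0<ι {40} (ℕ.s≤s ℕ.z≤n) , competitive
    where
    competitive : ∀ (n : ℕ) → 2 ℕ.≤ n → (M : FiniteMetricSpace n) → IsUniform M →
                  ∃ λ (A : BitAlgorithm M ⌈log₂ n ⌉) → IsCompetitive M ⌈log₂ n ⌉ (ι 40 * log₂ (ι n)) A
    competitive zero        () M uniform
    -- The additive constant is `double D` divided among the `m` agents.
    competitive n@(suc _) 2≤n M uniform = algorithm , κ + κ , λ c →
      inf-affine 0<α λ ρ {B} cost≤B → average (0≤B cost≤B) (algorithm-cost c m≤D phase≤D ρ cost≤B)
      where
      k = ⌈log₂ n ⌉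
      m = 2 ℕ.^ k
      κ = ι (10 ℕ.* k)
      D = ι m * κ
      α = ι 40 * log₂ (ι n)
      open Collective M uniform m

      κ+κ≤α : κ + κ ≤ α
      κ+κ≤α = begin
        κ + κ                      ≈⟨ +-cong (ι-* 10 k) (ι-* 10 k) ⟩
        ι 10 * ι k + ι 10 * ι k    ≈⟨ distribʳ (ι k) (ι 10) (ι 10) ⟨
        (ι 10 + ι 10) * ι k        ≈⟨ *-congʳ (ι-+ 10 10) ⟨
        ι 20 * ι k                 ≤⟨ *-monoˡ-≤ (0≤ι 20) (⌈log₂⌉≤2*log₂ 2≤n) ⟩
        ι 20 * (ι 2 * log₂ (ι n))  ≈⟨ *-assoc _ _ _ ⟨
        ι 20 * ι 2 * log₂ (ι n)    ≈⟨ *-congʳ (ι-* 20 2) ⟨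
        ι 40 * log₂ (ι n)          ∎

      1≤κ : 1# ≤ κ
      1≤κ = 1≤ι (ℕ.≤-trans (1≤⌈log₂n⌉ 2≤n) (ℕ.m≤n*m k 10))

      0<α : 0# < α
      0<α = 1≤x⇒0<x (≤-trans 1≤κ (≤-trans (x≤x+y κ (0≤ι (10 ℕ.* k))) κ+κ≤α))

      m≤D : ι m ≤ D
      m≤D = ≤-trans (≤-reflexive (sym (*-identityʳ (ι m)))) (*-monoˡ-≤ (0≤ι m) 1≤κ)

      phase≤D : ι m * (1# + 1#) + (ι (m ℕ.+ moveBound m n) + ι (m ℕ.+ moveBound m n)) ≤ D
      phase≤D = begin
        ι m * (1# + 1#) + (w + w)  ≈⟨ solve 3 (λ m w i → m :* (i :+ i) :+ (w :+ w)
                                                 := m :* (i :+ (i :+ con 0)) :+ (con 1 :+ (con 1 :+ con 0)) :* w)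
                                        refl (ι m) w 1# ⟩
        ι m * ι 2 + ι 2 * w        ≈⟨ trans (ι-+ (m ℕ.* 2) _) (+-cong (ι-* m 2) (ι-* 2 (m ℕ.+ moveBound m n))) ⟨
        ι (m ℕ.* 2 ℕ.+ 2 ℕ.* (m ℕ.+ moveBound m n))  ≤⟨ ι-mono-≤ (phase-bound n 2≤n) ⟩
        ι (m ℕ.* (10 ℕ.* k))       ≈⟨ ι-* m (10 ℕ.* k) ⟩
        D                          ∎
        where w = ι (m ℕ.+ moveBound m n)

      0≤B : ∀ {f B} → series f ≤⁺ [ B ] → 0# ≤ B
      0≤B {f} cost≤B = AddSupremum.[≤]-injective _≤_ (≤⁺-trans (series-nonNeg f) cost≤B)

      average : ∀ {F B} → 0# ≤ B → F ≤⁺ [ D * (B + B) + (D + D) ] → ι m ⁻¹ *⁺ F ≤⁺ [ α * B + (κ + κ) ]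
      average {B = B} 0≤B [ x≤ ] = [ x≤z*y⇒z⁻¹*x≤y (0<ι (ℕ.m^n>0 2 k)) (begin
        _                                 ≤⟨ x≤ ⟩
        D * (B + B) + (D + D)             ≈⟨ solve 3 (λ m k b → m :* k :* (b :+ b) :+ (m :* k :+ m :* k)
                                                           := m :* ((k :+ k) :* b :+ (k :+ k))) refl (ι m) κ B ⟩
        ι m * ((κ + κ) * B + (κ + κ))     ≤⟨ *-monoˡ-≤ (0≤ι m) (+-monoˡ-≤ _ (*-monoʳ-≤ 0≤B κ+κ≤α)) ⟩
        ι m * (α * B + (κ + κ))           ∎) ]

proposition1p3 : (lem : ExcludedMiddle 0ℓ) (R : CompleteOrderedField) →
    let open MTS lem R in
    (∀ (C : ℝ) → 0# < C → ∃ λ (C′ : ℝ) → 0# < C′ ×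
    (∀ (n : ℕ) → 3 ℕ.≤ n → (M : FiniteMetricSpace n) (b : ℕ) →
    (∃ λ (A : BitAlgorithm M b) → IsCompetitive M b (C * log₂ (ι n) ^ 2) A) →
    log₂ (ι n) - C′ * log₂ (log₂ (ι n)) ≤ ι b))
    ×
    (∃ λ (C″ : ℝ) → 0# < C″ ×
    (∀ (n : ℕ) → 2 ℕ.≤ n → (M : FiniteMetricSpace n) → IsUniform M →
    ∃ λ (A : BitAlgorithm M ⌈log₂ n ⌉) →
    IsCompetitive M ⌈log₂ n ⌉ (C″ * log₂ (ι n)) A))
proposition1p3 lem R =
  LowerBound.bits-lowerBound lem R , UpperBound.collective-competitive lem R
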